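{- For any integers $k>l\ge 2$, as $n\to\infty$, $$ex(n,C_{2l+1},\{C_3,C_4,\dots,C_{2l}\}\cup\{C_{2k}\})=\Omega(n^{1+\frac{1}{2k+1}})\quad\text{and}\quad ex(n,C_{2l+1},\{C_3,C_4,\dots,C_{2l}\}\cup\{C_{2k}\})=O(n^{1+\frac{l}{l+1}}).$$
   Context: $C_k$ denotes the cycle with $k$ vertices. For a graph $H$ and a family of graphs $\mathcal F$, $ex(n,H,\mathcal F)$ is the maximum number of subgraphs isomorphic to $H$ in an $n$-vertex graph containing no member of $\mathcal F$ as a subgraph. -}

module Defs where

open import Data.Bool using (Bool; true; false; T)
open import Data.Bool.Properties using (T?)
open import Data.Fin using (Fin; zero; suc; toℕ)
open import Data.Fin.Properties using (all?; any?) renaming (_≟_ to _≟ᶠ_)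
open import Data.Fin.Subset using (Subset; _∈_)
open import Data.Fin.Subset.Properties using (_∈?_)
open import Data.List using (List; []; _∷_; [_]; _++_; map; filter; length; allFin; applyUpTo; cartesianProduct; cartesianProductWith)
open import Data.List.Extrema.Nat using (max)
open import Data.List.Membership.Propositional using (lose) renaming (_∈_ to _∈ˡ_)
open import Data.List.Membership.Propositional.Properties using (∈-allFin; ∈-cartesianProduct⁺; ∈-cartesianProductWith⁺)
open import Data.List.Relation.Unary.All using (All) renaming (all? to allˡ?)
open import Data.List.Relation.Unary.Any using (here; there; satisfied) renaming (any? to anyˡ?)
open import Data.Nat using (ℕ; zero; suc; _+_; _*_; _∸_; _^_; _≤_; _≥_; _<_; NonZero)
open import Data.Nat.Properties using (_≟_)
open import Data.Product using (∃; ∃-syntax; _×_; _,_)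
open import Data.Sum using (_⊎_)
open import Data.Vec using (Vec; []; _∷_; lookup; tabulate)
open import Function using (_⇔_; mk⇔; Equivalence)
open import Function.Definitions using (Injective)
open import Level using (0ℓ)
open import Relation.Binary using (Rel; Decidable)
open import Relation.Binary.PropositionalEquality using (_≡_; refl)
open import Relation.Nullary using (¬_; Dec; does)
open import Relation.Nullary.Decidable using (map′; ¬?; _×-dec_; _⊎-dec_; _→-dec_)

-- A simple graph on the vertex set Fin n.  In  s ∷ G  the set s consists of the
-- neighbours of vertex zero among the other vertices, and G is the graph induced
-- on those.  Thus symmetry and irreflexivity hold by construction, and distinct
-- terms are distinct graphs on Fin n.
data Graph : ℕ → Set where
  []  : Graph 0
  _∷_ : ∀ {n} → Subset n → Graph n → Graph (suc n)

adjacent : ∀ {n} → Graph n → Fin n → Fin n → Bool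
adjacent (s ∷ G) zero    zero    = false
adjacent (s ∷ G) zero    (suc j) = lookup s j
adjacent (s ∷ G) (suc i) zero    = lookup s i
adjacent (s ∷ G) (suc i) (suc j) = adjacent G i j

Adj : ∀ {n} → Graph n → Rel (Fin n) 0ℓ
Adj G i j = T (adjacent G i j)

-- Vertices i < j are adjacent iff R i j; the values of R at i ≥ j are ignored.
fromRel : ∀ {n} {R : Rel (Fin n) 0ℓ} → Decidable R → Graph n
fromRel {zero}  R? = []
fromRel {suc n} R? = tabulate (λ j → does (R? zero (suc j))) ∷ fromRel (λ i j → R? (suc i) (suc j))

-- The cycle 0, 1, …, k-1, 0, meant for k ≥ 3.
C : (k : ℕ) → Graph k
C k = fromRel λ i j →
  (suc (toℕ i) ≟ toℕ j) ⊎-dec ((toℕ i ≟ 0) ×-dec (suc (toℕ j) ≟ k))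

-- A vertex set and an edge set; the edges are required to lie within the
-- vertex set in IsSubgraph.
Subgraph : ℕ → Set
Subgraph n = Subset n × Graph n

IsSubgraph : ∀ {n} → Graph n → Subgraph n → Set
IsSubgraph G (W , E) = ∀ i j → Adj E i j → Adj G i j × i ∈ W × j ∈ W

-- φ, given by its table of values, is a graph isomorphism from H onto (W , E).
IsIsomorphism : ∀ {h n} → Graph h → Subgraph n → Vec (Fin n) h → Set
IsIsomorphism H (W , E) φ =
  Injective _≡_ _≡_ (lookup φ) ×
  (∀ v → v ∈ W ⇔ (∃[ i ] lookup φ i ≡ v)) ×
  (∀ i j → Adj H i j ⇔ Adj E (lookup φ i) (lookup φ j))

IsCopy : ∀ {h n} → Graph h → Graph n → Subgraph n → Set
IsCopy H G S = IsSubgraph G S × ∃ (IsIsomorphism H S)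

-- A (finite) family of graphs.
Family : Set
Family = List (∃ Graph)

Free : ∀ {n} → Family → Graph n → Set
Free 𝓕 G = All (λ (_ , F) → ¬ ∃ (IsCopy F G)) 𝓕

vectors : ∀ {A : Set} → List A → ∀ n → List (Vec A n)
vectors xs zero    = [ [] ]
vectors xs (suc n) = cartesianProductWith _∷_ xs (vectors xs n)

subsets : ∀ n → List (Subset n)
subsets = vectors (true ∷ false ∷ [])

graphs : ∀ n → List (Graph n)
graphs zero    = [ [] ]
graphs (suc n) = cartesianProductWith _∷_ (subsets n) (graphs n)

subgraphs : ∀ n → List (Subgraph n)
subgraphs n = cartesianProduct (subsets n) (graphs n)

∈-vectors : ∀ {A : Set} {xs : List A} → (∀ x → x ∈ˡ xs) → ∀ {n} (v : Vec A n) → v ∈ˡ vectors xs n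
∈-vectors all []      = here refl
∈-vectors all (x ∷ v) = ∈-cartesianProductWith⁺ _∷_ (all x) (∈-vectors all v)

∈-subsets : ∀ {n} (s : Subset n) → s ∈ˡ subsets n
∈-subsets = ∈-vectors λ where
  true  → here refl
  false → there (here refl)

∈-graphs : ∀ {n} (G : Graph n) → G ∈ˡ graphs n
∈-graphs []      = here refl
∈-graphs (s ∷ G) = ∈-cartesianProductWith⁺ _∷_ (∈-subsets s) (∈-graphs G)

∈-subgraphs : ∀ {n} (S : Subgraph n) → S ∈ˡ subgraphs n
∈-subgraphs (W , E) = ∈-cartesianProduct⁺ (∈-subsets W) (∈-graphs E)

∃? : ∀ {A : Set} {P : A → Set} {xs : List A} → (∀ x → x ∈ˡ xs) → (∀ x → Dec (P x)) → Dec (∃ P)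
∃? {xs = xs} all P? = map′ satisfied (λ (x , px) → lose (all x) px) (anyˡ? P? xs)

_⇔-dec_ : ∀ {A B : Set} → Dec A → Dec B → Dec (A ⇔ B)
a? ⇔-dec b? = map′ (λ (f , g) → mk⇔ f g) (λ e → Equivalence.to e , Equivalence.from e)
                   ((a? →-dec b?) ×-dec (b? →-dec a?))

adj? : ∀ {n} (G : Graph n) → Decidable (Adj G)
adj? G i j = T? (adjacent G i j)

isSubgraph? : ∀ {n} (G : Graph n) (S : Subgraph n) → Dec (IsSubgraph G S)
isSubgraph? G (W , E) = all? λ i → all? λ j →
  adj? E i j →-dec (adj? G i j ×-dec (i ∈? W) ×-dec (j ∈? W))

isIsomorphism? : ∀ {h n} (H : Graph h) (S : Subgraph n) (φ : Vec (Fin n) h) → Dec (IsIsomorphism H S φ)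
isIsomorphism? H (W , E) φ =
  map′ (λ inj {i} {j} → inj i j) (λ inj i j → inj {i} {j})
    (all? λ i → all? λ j → (lookup φ i ≟ᶠ lookup φ j) →-dec (i ≟ᶠ j)) ×-dec
  (all? λ v → (v ∈? W) ⇔-dec any? λ i → lookup φ i ≟ᶠ v) ×-dec
  (all? λ i → all? λ j → adj? H i j ⇔-dec adj? E (lookup φ i) (lookup φ j))

isCopy? : ∀ {h n} (H : Graph h) (G : Graph n) (S : Subgraph n) → Dec (IsCopy H G S)
isCopy? H G S = isSubgraph? G S ×-dec ∃? (∈-vectors ∈-allFin) (isIsomorphism? H S)

free? : ∀ {n} (𝓕 : Family) (G : Graph n) → Dec (Free 𝓕 G)
free? 𝓕 G = allˡ? (λ (_ , F) → ¬? (∃? ∈-subgraphs (isCopy? F G))) 𝓕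

-- The number of subgraphs of G isomorphic to H: the list subgraphs n has no repetitions.
copies : ∀ {h n} → Graph h → Graph n → ℕ
copies {n = n} H G = length (filter (isCopy? H G) (subgraphs n))

-- The value is 0 if no graph on n vertices is 𝓕-free.
ex : ∀ {h} → ℕ → Graph h → Family → ℕ
ex n H 𝓕 = max 0 (map (copies H) (filter (free? 𝓕) (graphs n)))

-- C₃, C₄, …, C_m  (for m ≥ 2)
cycles3to : ℕ → Family
cycles3to m = applyUpTo (λ i → 3 + i , C (3 + i)) (m ∸ 2)

-- f(n) = Ω(n^(p/q)) and f(n) = O(n^(p/q)).  Since all quantities are nonnegative,
-- n^(p/q) ≤ c · f(n) is stated as the inequality of q-th powers, and likewise
-- for O.  Natural constants c suffice, as c may always be increased.
Ω[n^_/_] : (p q : ℕ) .{{_ : NonZero q}} → (ℕ → ℕ) → Set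
Ω[n^ p / q ] f = ∃[ c ] ∃[ N ] (0 < c × (∀ n → n ≥ N → n ^ p ≤ (c * f n) ^ q))

O[n^_/_] : (p q : ℕ) .{{_ : NonZero q}} → (ℕ → ℕ) → Set
O[n^ p / q ] f = ∃[ c ] ∃[ N ] (0 < c × (∀ n → n ≥ N → f n ^ q ≤ c ^ q * n ^ p))

{-# OPTIONS --safe #-}
module Submission where

-- Upper bound.  Since the girth exceeds 2l, a walk of length at most 2l without backtracking has no
-- repetition, so the vertices at distance l from a root v form the top level of a tree.  If the graph
-- between a set L of such vertices and a set R of vertices not nearer to v had large minimum degree,
-- an alternating path closed through the tree would give a C₂ₖ; hence it has O(|L| + |R|) edges.
-- A C₂ₗ₊₁ is determined by a root v and the opposite edge, which joins two vertices at distance l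
-- from v.  With Δ ≈ n^(1/(l+1)), take a vertex of degree > Δ as the root if there is one.  Cycles
-- without such a vertex number O(n Δ^l).  The others number O(P), where P counts pairs (v, x) at
-- distance l with deg v > Δ, and Δ P = O(n²), because the edges at v leading away from x go between
-- the vertices at distance l from x and vertices not nearer to x.
--
-- Lower bound.  Add copies of C₂ₗ₊₁ greedily, each on vertices of low degree at mutual distance at
-- least 2k.  A cycle of length at most 2k in the new graph either is old or uses new edges only, and
-- all its vertices then lie on the new copy, so no length other than 2l+1 occurs.  With maximum degree
-- about n^(1/(2k+1)) there is room until Ω(n^(1+1/(2k+1))) copies have been added.

open import Defs
open import Data.Bool using (Bool; true; false; T)
open import Data.Bool.Properties using (T-≡)
open import Data.Empty using (⊥; ⊥-elim)
open import Data.Fin as Fin using (Fin; zero; suc; toℕ; fromℕ<)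
open import Data.Fin.Properties using (any?; toℕ<n; toℕ-fromℕ<; toℕ-injective; toℕ-inject₁; injective⇒≤) renaming (_≟_ to _≟ᶠ_)
open import Data.Fin.Subset using () renaming (_∈_ to _∈ˢ_)
open import Data.Fin.Subset.Properties using (⊆-antisym)
open import Data.List as List using (List; []; _∷_; [_]; _++_; _∷ʳ_; _ʳ++_; map; filter; length; concatMap; allFin; applyUpTo; drop)
open import Data.List.Extrema.Nat using (xs≤max; argmax-all)
import Data.List.Membership.DecPropositional as DecMembership
open import Data.List.Membership.Propositional using (_∈_; _∉_; _─_; find; lose)
open import Data.List.Membership.Propositional.Properties
  using (∈-allFin; ∈-filter⁺; ∈-filter⁻; ∈-map⁺; ∈-map⁻; ∈-∃++; ∈-++⁻; ∈-concatMap⁺)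
open import Data.List.Properties
  using (length-++; length-map; length-removeAt′; length-tabulate; length-filter; length-applyUpTo; ++-assoc; ≡-dec; ∷-injectiveˡ; ∷-injectiveʳ)
open import Data.List.Relation.Unary.All as All using (All; []; _∷_)
import Data.List.Relation.Unary.All.Properties as All
open import Data.List.Relation.Unary.AllPairs using ([]; _∷_)
open import Data.List.Relation.Unary.Any as Any using (Any; here; there; index)
open import Data.List.Relation.Unary.Linked using (Linked; []; [-]; _∷_)
open import Data.List.Relation.Unary.Unique.Propositional using (Unique)
open import Data.List.Relation.Unary.Unique.Propositional.Properties
  using (filter⁺; allFin⁺; ++⁺; cartesianProduct⁺; cartesianProductWith⁺)
open import Data.Nat
open import Data.Nat.DivMod
open import Data.Nat.Properties
open import Data.Nat.Tactic.RingSolver using (solve-∀)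
open import Data.Product using (∃; ∃-syntax; _×_; _,_; proj₁; proj₂)
open import Data.Sum using (_⊎_; inj₁; inj₂)
open import Data.Unit using (⊤)
open import Data.Vec as Vec using (Vec; []; _∷_; lookup; tabulate; fromList; toList)
open import Data.Vec.Properties using (lookup∘tabulate; lookup⇒[]=; []=⇒lookup; length-toList; toList∘fromList)
open import Function using (_∘_; id; case_of_; _⇔_; mk⇔; Equivalence)
open import Function.Definitions using (Injective)
open import Level using (0ℓ)
open import Relation.Binary using (Rel; Decidable; Symmetric; tri<; tri≈; tri>)
open import Relation.Binary.PropositionalEquality hiding ([_])
open import Relation.Nullary using (¬_; Dec; yes; no; contradiction; does)
open import Relation.Nullary.Decidable using (_×-dec_; _⊎-dec_; ¬?; map′; decidable-stable)
import Relation.Unary as Unary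

private variable
  A B P Q : Set
  n m h : ℕ

-- Sums over lists and counting

∑ : List A → (A → ℕ) → ℕ
∑ []       f = 0
∑ (x ∷ xs) f = f x + ∑ xs f

infixr 5 ∑
syntax ∑ xs (λ x → e) = ∑[ x ∈ xs ] e

𝟙 : Dec P → ℕ
𝟙 (yes _) = 1
𝟙 (no  _) = 0

𝟙-mono : (p : Dec P) (q : Dec Q) → (P → Q) → 𝟙 p ≤ 𝟙 q
𝟙-mono (yes p) (yes _) f = ≤-refl
𝟙-mono (yes p) (no ¬q) f = contradiction (f p) ¬q
𝟙-mono (no _)  _       f = z≤n

𝟙-true : (p : Dec P) → P → 𝟙 p ≡ 1
𝟙-true (yes _) _ = refl
𝟙-true (no ¬p) p = contradiction p ¬p

∑-mono : ∀ (xs : List A) {f g : A → ℕ} → (∀ {x} → x ∈ xs → f x ≤ g x) → ∑ xs f ≤ ∑ xs g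
∑-mono []       h = z≤n
∑-mono (x ∷ xs) h = +-mono-≤ (h (here refl)) (∑-mono xs (h ∘ there))

∑-distrib-+ : ∀ (xs : List A) {f g : A → ℕ} → ∑[ x ∈ xs ] (f x + g x) ≡ ∑ xs f + ∑ xs g
∑-distrib-+ []       = refl
∑-distrib-+ (x ∷ xs) {f} {g} rewrite ∑-distrib-+ xs {f} {g} = lem (f x) (g x) (∑ xs f) (∑ xs g)
  where
  lem : ∀ a b c d → a + b + (c + d) ≡ a + c + (b + d)
  lem = solve-∀

∑-*ˡ : ∀ (xs : List A) c {f : A → ℕ} → ∑[ x ∈ xs ] (c * f x) ≡ c * ∑ xs f
∑-*ˡ []       c = sym (*-zeroʳ c)
∑-*ˡ (x ∷ xs) c {f} = trans (cong (c * f x +_) (∑-*ˡ xs c)) (sym (*-distribˡ-+ c (f x) _))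

∑-const : ∀ (xs : List A) c → ∑[ _ ∈ xs ] c ≡ length xs * c
∑-const []       c = refl
∑-const (x ∷ xs) c = cong (c +_) (∑-const xs c)

∑-≤-const : ∀ (xs : List A) {c} {f : A → ℕ} → (∀ {x} → x ∈ xs → f x ≤ c) → ∑ xs f ≤ length xs * c
∑-≤-const xs h = ≤-trans (∑-mono xs h) (≤-reflexive (∑-const xs _))

∑-zero : ∀ (xs : List A) → ∑[ _ ∈ xs ] 0 ≡ 0
∑-zero []       = refl
∑-zero (_ ∷ xs) = ∑-zero xs

∑-swap : ∀ (xs : List A) (ys : List B) (f : A → B → ℕ) →
         ∑[ x ∈ xs ] ∑[ y ∈ ys ] f x y ≡ ∑[ y ∈ ys ] ∑[ x ∈ xs ] f x y
∑-swap []       ys f = sym (∑-zero ys)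
∑-swap (x ∷ xs) ys f = trans (cong (∑ ys (f x) +_) (∑-swap xs ys f)) (sym (∑-distrib-+ ys))

∑-filter : ∀ {P : A → Set} (P? : Unary.Decidable P) xs (f : A → ℕ) →
           ∑ (filter P? xs) f ≡ ∑[ x ∈ xs ] (𝟙 (P? x) * f x)
∑-filter P? []       f = refl
∑-filter P? (x ∷ xs) f with P? x
... | yes _ = cong₂ _+_ (sym (+-identityʳ (f x))) (∑-filter P? xs f)
... | no  _ = ∑-filter P? xs f

length-filter-∑ : ∀ {P : A → Set} (P? : Unary.Decidable P) xs → length (filter P? xs) ≡ ∑[ x ∈ xs ] 𝟙 (P? x)
length-filter-∑ P? []       = refl
length-filter-∑ P? (x ∷ xs) with P? x
... | yes _ = cong suc (length-filter-∑ P? xs)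
... | no  _ = length-filter-∑ P? xs

∑-∈ : ∀ {xs : List A} {x} (f : A → ℕ) → x ∈ xs → f x ≤ ∑ xs f
∑-∈ f (here refl) = m≤m+n _ _
∑-∈ f (there p)   = ≤-trans (∑-∈ f p) (m≤n+m _ _)

∑-remove : ∀ {xs : List A} {x} (f : A → ℕ) (x∈xs : x ∈ xs) → ∑ xs f ≡ f x + ∑ (xs ─ x∈xs) f
∑-remove f (here refl) = refl
∑-remove {xs = y ∷ _} {x} f (there p) =
  trans (cong (f y +_) (∑-remove f p)) (lem (f y) (f x) _)
  where
  lem : ∀ a b c → a + (b + c) ≡ b + (a + c)
  lem = solve-∀

length-─ : ∀ {xs : List A} {x} (x∈xs : x ∈ xs) → length xs ≡ suc (length (xs ─ x∈xs))
length-─ {xs = xs} p = length-removeAt′ xs (index p)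

∈-─⁻ : ∀ {xs : List A} {x z} (x∈xs : x ∈ xs) → z ∈ xs ─ x∈xs → z ∈ xs
∈-─⁻ (here refl) q         = there q
∈-─⁻ (there p)   (here e)  = here e
∈-─⁻ (there p)   (there q) = there (∈-─⁻ p q)

∈-─⁺ : ∀ {xs : List A} {x z} (x∈xs : x ∈ xs) → z ∈ xs → z ≢ x → z ∈ xs ─ x∈xs
∈-─⁺ (here refl) (here e)  z≢x = contradiction e z≢x
∈-─⁺ (here refl) (there q) z≢x = q
∈-─⁺ (there p)   (here e)  z≢x = here e
∈-─⁺ (there p)   (there q) z≢x = there (∈-─⁺ p q z≢x)

Unique-─ : ∀ {xs : List A} {x} (x∈xs : x ∈ xs) → Unique xs → Unique (xs ─ x∈xs)
Unique-─ (here _)  (_ ∷ u) = u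
Unique-─ (there p) (a ∷ u) = All.tabulate (λ q → All.lookup a (∈-─⁻ p q)) ∷ Unique-─ p u

-- The partner of the first element is removed from `ys`, and injectivity keeps the other partners.
-- A relation rather than a function is used because partners are later found from proofs.
pigeonhole : (_~_ : A → B → Set) → (∀ {x y z} → x ~ z → y ~ z → x ≡ y) →
             ∀ {xs ys} → Unique xs → (∀ {x} → x ∈ xs → ∃ λ y → y ∈ ys × x ~ y) → length xs ≤ length ys
pigeonhole _~_ inj []                         total = z≤n
pigeonhole _~_ inj {x ∷ xs} {ys} (x∉xs ∷ u) total =
  let y , y∈ , x~y = total (here refl) in
  subst (suc (length xs) ≤_) (sym (length-─ y∈))
    (s≤s (pigeonhole _~_ inj u λ {z} z∈ →
      let w , w∈ , z~w = total (there z∈) in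
      w , ∈-─⁺ y∈ w∈ (λ w≡y → All.lookup x∉xs z∈ (inj x~y (subst (z ~_) w≡y z~w))) , z~w))

Unique-⊆⇒length≤ : ∀ {xs ys : List A} → Unique xs → (∀ {z} → z ∈ xs → z ∈ ys) → length xs ≤ length ys
Unique-⊆⇒length≤ u sub = pigeonhole _≡_ (λ p q → trans p (sym q)) u λ z∈ → _ , sub z∈ , refl

-- If all elements with `P` lay in `zs`, the filtered list, which has no repetition, could not be
-- longer than `zs`. This picks fresh vertices in both bounds.
filter-escape : ∀ {P : A → Set} (P? : Unary.Decidable P) {xs} (_≟ᴬ_ : (x y : A) → Dec (x ≡ y)) (zs : List A) →
                Unique xs → length zs < ∑[ x ∈ xs ] 𝟙 (P? x) → ∃ λ x → x ∈ xs × P x × x ∉ zs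
filter-escape P? {xs} _≟ᴬ_ zs u lt with Any.any? (λ x → ¬? (x ∈? zs)) (filter P? xs)
  where
  open DecMembership _≟ᴬ_ using (_∈?_)
... | yes h = let x , x∈ , x∉zs = find h ; x∈xs , px = ∈-filter⁻ P? x∈ in x , x∈xs , px , x∉zs
... | no ¬h = contradiction
  (≤-trans (≤-reflexive (sym (length-filter-∑ P? xs)))
    (Unique-⊆⇒length≤ (filter⁺ P? u) λ {z} z∈ → decidable-stable (z ∈? zs) λ z∉ → ¬h (Any.map (λ { refl → z∉ }) z∈)))
  (<⇒≱ lt)
  where
  open DecMembership _≟ᴬ_ using (_∈?_)

length-concatMap-∑ : ∀ (xs : List A) (f : A → List B) → length (concatMap f xs) ≡ ∑[ x ∈ xs ] length (f x)
length-concatMap-∑ []       f = refl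
length-concatMap-∑ (x ∷ xs) f = trans (length-++ (f x)) (cong (length (f x) +_) (length-concatMap-∑ xs f))

length-allFin : ∀ n → length (allFin n) ≡ n
length-allFin n = length-tabulate id

filter-subset-< : ∀ {P Q : A → Set} (P? : Unary.Decidable P) (Q? : Unary.Decidable Q) {xs} →
  (∀ {x} → P x → Q x) → ∀ {y} → y ∈ xs → Q y → ¬ P y →
  length (filter P? xs) < length (filter Q? xs)
filter-subset-< P? Q? {xs} P⊆Q {y} y∈ qy ¬py
  rewrite length-filter-∑ P? xs | length-filter-∑ Q? xs
        | ∑-remove (λ x → 𝟙 (P? x)) y∈ | ∑-remove (λ x → 𝟙 (Q? x)) y∈
        | 𝟙-true (Q? y) qy
  with P? y
... | yes py = contradiction py ¬py
... | no  _  = s≤s (∑-mono (xs ─ y∈) (λ _ → 𝟙-mono (P? _) (Q? _) P⊆Q))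

∑-≟≤1 : ∀ {n} (u : Fin n) → ∑[ w ∈ allFin n ] 𝟙 (u ≟ᶠ w) ≤ 1
∑-≟≤1 {n} u = ≤-trans (≤-reflexive (sym (length-filter-∑ (u ≟ᶠ_) (allFin n))))
  (Unique-⊆⇒length≤ {ys = u ∷ []} (filter⁺ (u ≟ᶠ_) (allFin⁺ n)) λ z∈ → here (sym (proj₂ (∈-filter⁻ (u ≟ᶠ_) {xs = allFin n} z∈))))

length-filter≤n : ∀ {n} {P : Fin n → Set} (P? : Unary.Decidable P) → length (filter P? (allFin n)) ≤ n
length-filter≤n {n} P? = ≤-trans (length-filter P? (allFin n)) (≤-reflexive (length-allFin n))

-- Walks along a relation, and integer roots

module _ {n} {_~_ : Fin n → Fin n → Set} (_~?_ : ∀ u v → Dec (u ~ v)) where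

  -- The relation iterated `s` times. It serves for walks through vertices of low degree and for
  -- bounded distance.
  Pow : ℕ → Fin n → Fin n → Set
  Pow zero    v x = v ≡ x
  Pow (suc s) v x = ∃ λ w → Pow s v w × w ~ x

  pow? : ∀ s v x → Dec (Pow s v x)
  pow? zero    v x = v ≟ᶠ x
  pow? (suc s) v x = any? λ w → pow? s v w ×-dec (w ~? x)

  Pow-walk : ∀ s (f : ℕ → Fin n) → (∀ {t} → t < s → f t ~ f (suc t)) → Pow s (f 0) (f s)
  Pow-walk zero    f step = refl
  Pow-walk (suc s) f step = f s , Pow-walk s f (step ∘ m≤n⇒m≤1+n) , step ≤-refl

  𝟙-pow≤ : ∀ s v x → 𝟙 (pow? (suc s) v x) ≤ ∑[ w ∈ allFin n ] 𝟙 (pow? s v w) * 𝟙 (w ~? x)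
  𝟙-pow≤ s v x with pow? (suc s) v x
  ... | no _ = z≤n
  ... | yes (w , p , q) = ≤-trans (≤-reflexive (sym (cong₂ _*_ (𝟙-true (pow? s v w) p) (𝟙-true (w ~? x) q))))
                                 (∑-∈ (λ w → 𝟙 (pow? s v w) * 𝟙 (w ~? x)) (∈-allFin w))

  -- A union bound over the last step multiplies the number of ends by at most `d`.
  pow-count : ∀ {d} → (∀ w → ∑[ x ∈ allFin n ] 𝟙 (w ~? x) ≤ d) → ∀ s v → ∑[ x ∈ allFin n ] 𝟙 (pow? s v x) ≤ d ^ s
  pow-count         out zero    v = ∑-≟≤1 v
  pow-count {d = d} out (suc s) v = begin
    ∑[ x ∈ V ] 𝟙 (pow? (suc s) v x)                          ≤⟨ ∑-mono V (λ {x} _ → 𝟙-pow≤ s v x) ⟩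
    ∑[ x ∈ V ] ∑[ w ∈ V ] 𝟙 (pow? s v w) * 𝟙 (w ~? x)        ≡⟨ ∑-swap V V _ ⟩
    ∑[ w ∈ V ] ∑[ x ∈ V ] 𝟙 (pow? s v w) * 𝟙 (w ~? x)        ≤⟨ ∑-mono V (λ {w} _ → ≤-trans (≤-reflexive (∑-*ˡ V (𝟙 (pow? s v w)))) (≤-trans (*-monoʳ-≤ (𝟙 (pow? s v w)) (out w)) (≤-reflexive (*-comm _ d)))) ⟩
    ∑[ w ∈ V ] d * 𝟙 (pow? s v w)                            ≡⟨ ∑-*ˡ V d ⟩
    d * (∑[ w ∈ V ] 𝟙 (pow? s v w))                          ≤⟨ *-monoʳ-≤ d (pow-count out s v) ⟩
    d * d ^ s                                                ∎
    where
    open ≤-Reasoning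
    V = allFin n

-- The floor of the root of order q + 1. It grows by at most one when `n` does, since consecutive
-- powers differ by at least one.
root : ∀ q n → ∃ λ s → s ^ suc q ≤ n × n < suc s ^ suc q
root q zero    = 0 , z≤n , subst (0 <_) (sym (^-zeroˡ (suc q))) (s≤s z≤n)
root q (suc n) with s , lo , hi ← root q n | suc n <? suc s ^ suc q
... | yes lt = s , m≤n⇒m≤1+n lo , lt
... | no ¬lt = suc s , ≮⇒≥ ¬lt , ≤-<-trans hi (^-monoˡ-< (suc q) ≤-refl)

-- Graphs and unrolled cycles

Adj-irrefl : ∀ (G : Graph n) {i} → ¬ Adj G i i
Adj-irrefl (s ∷ G) {zero}  ()
Adj-irrefl (s ∷ G) {suc i} = Adj-irrefl G

Adj-sym : ∀ (G : Graph n) {i j} → Adj G i j → Adj G j i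
Adj-sym (s ∷ G) {zero}  {suc j} a = a
Adj-sym (s ∷ G) {suc i} {zero}  a = a
Adj-sym (s ∷ G) {suc i} {suc j} a = Adj-sym G a

Adj-≢ : ∀ (G : Graph n) {i j} → Adj G i j → i ≢ j
Adj-≢ G a refl = Adj-irrefl G a

T-does : ∀ {P : Set} (p : Dec P) → T (does p) → P
T-does (yes p) _ = p

does-T : ∀ {P : Set} (p : Dec P) → P → T (does p)
does-T (yes _) _ = _
does-T (no ¬p) p = ¬p p

adjacent-fromRel : ∀ {R : Rel (Fin n) 0ℓ} (R? : Decidable R) {i j} → i Fin.< j →
                   adjacent (fromRel R?) i j ≡ does (R? i j)
adjacent-fromRel {suc n} R? {zero}  {suc j} _       = lookup∘tabulate (λ j → does (R? zero (suc j))) j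
adjacent-fromRel {suc n} R? {suc i} {suc j} (s≤s l) = adjacent-fromRel (λ i j → R? (suc i) (suc j)) l

module _ {R : Rel (Fin n) 0ℓ} (R? : Decidable R) where

  fromRel-<⁺ : ∀ {i j} → i Fin.< j → R i j → Adj (fromRel R?) i j
  fromRel-<⁺ i<j r = subst T (sym (adjacent-fromRel R? i<j)) (does-T (R? _ _) r)

  fromRel-<⁻ : ∀ {i j} → i Fin.< j → Adj (fromRel R?) i j → R i j
  fromRel-<⁻ i<j a = T-does (R? _ _) (subst T (adjacent-fromRel R? i<j) a)

  fromRel⁺ : Symmetric R → (∀ {i} → ¬ R i i) → ∀ {i j} → R i j → Adj (fromRel R?) i j
  fromRel⁺ R-sym R-irr {i} {j} r with <-cmp (toℕ i) (toℕ j)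
  ... | tri< l _ _ = fromRel-<⁺ l r
  ... | tri> _ _ g = Adj-sym (fromRel R?) (fromRel-<⁺ g (R-sym r))
  ... | tri≈ _ e _ with refl ← toℕ-injective e = contradiction r R-irr

  fromRel⁻ : Symmetric R → ∀ {i j} → Adj (fromRel R?) i j → R i j
  fromRel⁻ R-sym {i} {j} a with <-cmp (toℕ i) (toℕ j)
  ... | tri< l _ _ = fromRel-<⁻ l a
  ... | tri> _ _ g = R-sym (fromRel-<⁻ g (Adj-sym (fromRel R?) a))
  ... | tri≈ _ e _ with refl ← toℕ-injective e = contradiction a (Adj-irrefl (fromRel R?))

Graph-ext : ∀ (G H : Graph n) → (∀ i j → Adj G i j ⇔ Adj H i j) → G ≡ H
Graph-ext []      []      e = refl
Graph-ext (s ∷ G) (t ∷ H) e = cong₂ _∷_ (lookup-ext s t (λ j → T-ext (e zero (suc j))))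
                                        (Graph-ext G H (λ i j → e (suc i) (suc j)))
  where
  T-ext : ∀ {b c} → T b ⇔ T c → b ≡ c
  T-ext {false} {false} e = refl
  T-ext {false} {true}  e = contradiction (Equivalence.from e _) id
  T-ext {true}  {false} e = contradiction (Equivalence.to e _) id
  T-ext {true}  {true}  e = refl

  lookup-ext : ∀ {m} (s t : Vec Bool m) → (∀ j → lookup s j ≡ lookup t j) → s ≡ t
  lookup-ext []      []      e = refl
  lookup-ext (x ∷ s) (y ∷ t) e = cong₂ _∷_ (e zero) (lookup-ext s t (e ∘ suc))

deg : Graph n → Fin n → ℕ
deg {n} G v = ∑[ w ∈ allFin n ] 𝟙 (adj? G v w)

-- Successors on a cycle

Next : ℕ → ℕ → ℕ → Set
Next m a b = suc a ≡ b ⊎ (suc a ≡ m × b ≡ 0)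

Next-functional : ∀ {a b c} → b < m → c < m → Next m a b → Next m a c → b ≡ c
Next-functional b<m c<m (inj₁ p)       (inj₁ q)       = trans (sym p) q
Next-functional b<m c<m (inj₁ p)       (inj₂ (q , _)) = contradiction (trans (sym p) q) (<⇒≢ b<m)
Next-functional b<m c<m (inj₂ (p , _)) (inj₁ q)       = contradiction (trans (sym q) p) (<⇒≢ c<m)
Next-functional b<m c<m (inj₂ (_ , p)) (inj₂ (_ , q)) = trans p (sym q)

Next-injective : ∀ {a b c} → Next m a c → Next m b c → a ≡ b
Next-injective (inj₁ p)       (inj₁ q)       = suc-injective (trans p (sym q))
Next-injective (inj₁ refl)    (inj₂ (_ , ()))
Next-injective (inj₂ (_ , ())) (inj₁ refl)
Next-injective (inj₂ (p , _)) (inj₂ (q , _)) = suc-injective (trans p (sym q))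

_↝_ : Fin m → Fin m → Set
_↝_ {m} i j = Next m (toℕ i) (toℕ j)

Adj-C⁻ : ∀ {i j : Fin m} → Adj (C m) i j → i ↝ j ⊎ j ↝ i
Adj-C⁻ {m} {i} {j} a with <-cmp (toℕ i) (toℕ j)
... | tri≈ _ e _ with refl ← toℕ-injective e = contradiction a (Adj-irrefl (C m))
... | tri< l _ _ with fromRel-<⁻ _ l a
...   | inj₁ e       = inj₁ (inj₁ e)
-- The closing edge is stored from 0 to the last vertex, against the cyclic orientation.
...   | inj₂ (p , q) = inj₂ (inj₂ (q , p))
Adj-C⁻ {m} {i} {j} a | tri> _ _ g with fromRel-<⁻ _ g (Adj-sym (C m) a)
...   | inj₁ e       = inj₂ (inj₁ e)
...   | inj₂ (p , q) = inj₁ (inj₂ (q , p))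

Adj-C⁺ : ∀ {i j : Fin m} → 2 ≤ m → i ↝ j → Adj (C m) i j
Adj-C⁺ 2≤m (inj₁ e)       = fromRel-<⁺ _ (≤-reflexive e) (inj₁ e)
Adj-C⁺ {m} {i} {j} 2≤m (inj₂ (p , q)) = Adj-sym (C m) (fromRel-<⁺ _ j<i (inj₂ (q , p)))
  where
  j<i : toℕ j < toℕ i
  j<i rewrite q = s≤s⁻¹ (subst (2 ≤_) (sym p) 2≤m)

next : ∀ (i : Fin m) → ∃ λ j → i ↝ j
next {suc m} i with suc (toℕ i) ≟ suc m
... | yes e = zero , inj₂ (e , refl)
... | no ¬e = fromℕ< l , inj₁ (sym (toℕ-fromℕ< l))
  where l = ≤∧≢⇒< (toℕ<n i) ¬e

prev : ∀ (i : Fin m) → ∃ λ j → j ↝ i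
prev {suc m} zero    = fromℕ< {m} ≤-refl , inj₂ (cong suc (toℕ-fromℕ< _) , refl)
prev {suc m} (suc i) = Fin.inject₁ i , inj₁ (cong suc (toℕ-inject₁ i))

↝-functional : ∀ {i j k : Fin m} → i ↝ j → i ↝ k → j ≡ k
↝-functional {j = j} {k} p q = toℕ-injective (Next-functional (toℕ<n j) (toℕ<n k) p q)

↝-injective : ∀ {i j k : Fin m} → i ↝ k → j ↝ k → i ≡ j
↝-injective p q = toℕ-injective (Next-injective p q)

deg-C≤2 : ∀ (i : Fin m) → deg (C m) i ≤ 2
deg-C≤2 {m} i = ≤-trans (≤-reflexive (sym (length-filter-∑ (adj? (C m) i) (allFin m))))
  (Unique-⊆⇒length≤ {ys = proj₁ (next i) ∷ proj₁ (prev i) ∷ []} (filter⁺ (adj? (C m) i) (allFin⁺ m)) λ z∈ →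
    case Adj-C⁻ (proj₂ (∈-filter⁻ (adj? (C m) i) {xs = allFin m} z∈)) of λ where
      (inj₁ p) → here (↝-functional p (proj₂ (next i)))
      (inj₂ p) → there (here (↝-injective p (proj₂ (prev i)))))

-- A cycle of length m as a periodic sequence of vertices.
record Cycle (G : Graph n) (m : ℕ) : Set where
  field
    ψ        : ℕ → Fin n
    periodic : ∀ t → ψ (t + m) ≡ ψ t
    adjacent-suc : ∀ t → Adj G (ψ t) (ψ (suc t))
    distinct : ∀ {s t} → s < t → t < s + m → ψ s ≢ ψ t

  shift : ℕ → Cycle G m
  shift r = record
    { ψ            = λ t → ψ (r + t)
    ; periodic     = λ t → trans (cong ψ (sym (+-assoc r t m))) (periodic (r + t))
    ; adjacent-suc = λ t → subst (λ u → Adj G (ψ (r + t)) (ψ u)) (sym (+-suc r t)) (adjacent-suc (r + t))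
    ; distinct     = λ {s} {t} s<t t<s+m → distinct (+-monoʳ-< r s<t) (subst (r + t <_) (sym (+-assoc r s m)) (+-monoʳ-< r t<s+m))
    }

module _ {m : ℕ} .{{_ : NonZero m}} where

  Next-% : ∀ t → Next m (t % m) (suc t % m)
  Next-% t with suc (t % m) <? m
  ... | yes l = inj₁ (sym (trans (eq t) (m<n⇒m%n≡m l)))
    where
    eq : ∀ t → suc t % m ≡ suc (t % m) % m
    eq t = trans (%-distribˡ-+ 1 t m) (trans (cong (λ z → (1 % m + z) % m) (sym (m%n%n≡m%n t m))) (sym (%-distribˡ-+ 1 (t % m) m)))
  ... | no ¬l = inj₂ (e , trans (%-distribˡ-+ 1 t m)
                     (trans (cong (λ z → (1 % m + z) % m) (sym (m%n%n≡m%n t m)))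
                     (trans (sym (%-distribˡ-+ 1 (t % m) m)) (trans (cong (_% m) e) (n%n≡0 m)))))
    where e = ≤-antisym (m%n<n t m) (≮⇒≥ ¬l)

  -- Equal residues have equal predecessors by `Next-injective`, so both arguments move down
  -- together until the smaller is 0 and the other is still below `m`.
  %-distinct : ∀ {s t} → s < t → t < s + m → s % m ≢ t % m
  %-distinct {zero}  {t} s<t t<m e = <⇒≢ s<t (trans (sym (m<n⇒m%n≡m (<-trans s<t t<m))) (trans e (m<n⇒m%n≡m t<m)))
  %-distinct {suc s} {suc t} (s≤s s<t) (s≤s t<m) e =
    %-distinct s<t t<m (Next-injective (subst (Next m (s % m)) e (Next-% s)) (Next-% t))

  toℕ-mod : ∀ t → toℕ (t mod m) ≡ t % m
  toℕ-mod t = toℕ-fromℕ< (m%n<n t m)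

unroll : ∀ {G : Graph n} {φ : Vec (Fin n) (suc m)} → 1 ≤ m → Injective _≡_ _≡_ (lookup φ) →
         (∀ i j → Adj (C (suc m)) i j → Adj G (lookup φ i) (lookup φ j)) → Cycle G (suc m)
unroll {m = m} {φ = φ} 1≤m inj hom = record
  { ψ            = λ t → lookup φ (t mod suc m)
  ; periodic     = λ t → cong (lookup φ) (toℕ-injective (trans (toℕ-mod (t + suc m)) (trans ([m+n]%n≡m%n t (suc m)) (sym (toℕ-mod t)))))
  ; adjacent-suc = λ t → hom _ _ (Adj-C⁺ (s≤s 1≤m) (subst₂ (Next (suc m)) (sym (toℕ-mod t)) (sym (toℕ-mod (suc t))) (Next-% t)))
  ; distinct     = λ {s} {t} s<t t<s+m e → %-distinct s<t t<s+m
      (trans (sym (toℕ-mod s)) (trans (cong toℕ (inj e)) (toℕ-mod t)))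
  }

∈-tabulate⁺ : ∀ {P : Fin n → Set} (P? : ∀ v → Dec (P v)) {v} → P v → v ∈ˢ tabulate (does ∘ P?)
∈-tabulate⁺ P? {v} p = lookup⇒[]= v _ (trans (lookup∘tabulate (does ∘ P?) v) (Equivalence.to T-≡ (does-T (P? v) p)))

∈-tabulate⁻ : ∀ {P : Fin n → Set} (P? : ∀ v → Dec (P v)) {v} → v ∈ˢ tabulate (does ∘ P?) → P v
∈-tabulate⁻ P? {v} v∈ = T-does (P? v) (Equivalence.from T-≡ (trans (sym (lookup∘tabulate (does ∘ P?) v)) ([]=⇒lookup v∈)))

-- The copy traced out by an injective map

module _ (H : Graph h) (φ : Vec (Fin n) h) where

  ImageAdj : Rel (Fin n) 0ℓ
  ImageAdj u v = ∃[ i ] ∃[ j ] (lookup φ i ≡ u × lookup φ j ≡ v × Adj H i j)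

  imageAdj? : Decidable ImageAdj
  imageAdj? u v = any? λ i → any? λ j → (lookup φ i ≟ᶠ u) ×-dec (lookup φ j ≟ᶠ v) ×-dec adj? H i j

  ImageAdj-sym : Symmetric ImageAdj
  ImageAdj-sym (i , j , p , q , a) = j , i , q , p , Adj-sym H a

  ∈image? : ∀ v → Dec (∃[ i ] lookup φ i ≡ v)
  ∈image? v = any? λ i → lookup φ i ≟ᶠ v

  image : Subgraph n
  image = tabulate (does ∘ ∈image?) , fromRel imageAdj?

  module _ (inj : Injective _≡_ _≡_ (lookup φ)) where

    ImageAdj-irrefl : ∀ {v} → ¬ ImageAdj v v
    ImageAdj-irrefl (i , j , p , q , a) = Adj-≢ H a (inj (trans p (sym q)))

    -- A homomorphism into `G` suffices: the edge set of the copy is the image of the edges of `H`,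
    -- so adjacency is reflected by injectivity even if `G` has further edges.
    image-isCopy : ∀ {G : Graph n} → (∀ i j → Adj H i j → Adj G (lookup φ i) (lookup φ j)) → IsCopy H G image
    image-isCopy {G} hom =
      (λ u v a → let i , j , p , q , b = fromRel⁻ imageAdj? ImageAdj-sym a in
        subst₂ (Adj G) p q (hom i j b) , ∈-tabulate⁺ ∈image? (i , p) , ∈-tabulate⁺ ∈image? (j , q)) ,
      φ , inj ,
      (λ v → mk⇔ (∈-tabulate⁻ ∈image?) (∈-tabulate⁺ ∈image?)) ,
      λ i j → mk⇔ (λ a → fromRel⁺ imageAdj? ImageAdj-sym ImageAdj-irrefl (i , j , refl , refl , a))
                  (λ a → let i' , j' , p , q , b = fromRel⁻ imageAdj? ImageAdj-sym a in
                         subst₂ (Adj H) (inj p) (inj q) b)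

copy⇒Cycle : ∀ {G : Graph n} → 2 ≤ m → ∃ (IsCopy (C m) G) → Cycle G m
copy⇒Cycle {m = suc m} (s≤s 1≤m) ((W , E) , sub , φ , inj , _ , iso) =
  unroll {φ = φ} 1≤m inj λ i j a → proj₁ (sub _ _ (Equivalence.to (iso i j) a))

copies≤ex : ∀ {H : Graph h} {𝓕} {G : Graph n} → Free 𝓕 G → copies H G ≤ ex n H 𝓕
copies≤ex {n = n} {H = H} {𝓕} {G} free =
  All.lookup (xs≤max 0 _) (∈-map⁺ (copies H) (∈-filter⁺ (free? 𝓕) (∈-graphs G) free))

-- Non-backtracking walks

Unique-prefix : ∀ {A : Set} {xs : List A} {y zs} → Unique (xs ++ y ∷ zs) → Unique (y ∷ xs)
Unique-prefix {xs = []}     _       = [] ∷ []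
Unique-prefix {xs = x ∷ xs} (a ∷ u) with Unique-prefix {xs = xs} u | All.++⁻ˡ xs a | All.++⁻ʳ xs a
... | b ∷ u' | a' | x≢y ∷ _ = ((x≢y ∘ sym) ∷ b) ∷ a' ∷ u'

Linked-prefix : ∀ {A : Set} {R : Rel A 0ℓ} (xs : List A) {y zs} → Linked R (xs ++ y ∷ zs) → Linked R (xs ∷ʳ y)
Linked-prefix []           _       = [-]
Linked-prefix (x ∷ [])     (r ∷ l) = r ∷ [-]
Linked-prefix (x ∷ y ∷ xs) (r ∷ l) = r ∷ Linked-prefix (y ∷ xs) l

Linked-join : ∀ {A : Set} {R : Rel A 0ℓ} (xs : List A) {y zs} → Linked R (xs ∷ʳ y) → Linked R (y ∷ zs) → Linked R (xs ++ y ∷ zs)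
Linked-join []           _       l' = l'
Linked-join (x ∷ [])     (r ∷ _) l' = r ∷ l'
Linked-join (x ∷ y ∷ xs) (r ∷ l) l' = r ∷ Linked-join (y ∷ xs) l l'

module _ {A : Set} {R : Rel A 0ℓ} where

  -- The two clauses match the two cases of `Next`; for a closed walk, `w` is its starting vertex.
  Linked-lookup : ∀ {xs : List A} {w} → Linked R (xs ∷ʳ w) → ∀ (i : Fin (length xs)) →
                  (∀ j → suc (toℕ i) ≡ toℕ j → R (Vec.lookup (fromList xs) i) (Vec.lookup (fromList xs) j)) ×
                  (suc (toℕ i) ≡ length xs → R (Vec.lookup (fromList xs) i) w)
  Linked-lookup {x ∷ []}     (r ∷ _) zero    = (λ { zero () }) , λ _ → r
  Linked-lookup {x ∷ y ∷ xs} (r ∷ l) zero    = (λ { (suc zero) _ → r ; (suc (suc j)) () }) , λ ()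
  Linked-lookup {x ∷ y ∷ xs} (r ∷ l) (suc i) =
    (λ { (suc j) e → proj₁ (Linked-lookup l i) j (suc-injective e) }) , λ e → proj₂ (Linked-lookup l i) (suc-injective e)

lookup∈ : ∀ {A : Set} (xs : List A) i → Vec.lookup (fromList xs) i ∈ xs
lookup∈ (x ∷ xs) zero    = here refl
lookup∈ (x ∷ xs) (suc i) = there (lookup∈ xs i)

Unique⇒lookup-injective : ∀ {A : Set} {xs : List A} → Unique xs → Injective _≡_ _≡_ (Vec.lookup (fromList xs))
Unique⇒lookup-injective (a ∷ u) {zero}  {zero}  e = refl
Unique⇒lookup-injective (a ∷ u) {zero}  {suc j} e = contradiction e (All.lookup a (lookup∈ _ j))
Unique⇒lookup-injective (a ∷ u) {suc i} {zero}  e = contradiction (sym e) (All.lookup a (lookup∈ _ i))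
Unique⇒lookup-injective (a ∷ u) {suc i} {suc j} e = cong suc (Unique⇒lookup-injective u e)

-- A walk is kept as its start and the list of its further vertices, so the length of the list is
-- the number of edges.
end : ∀ {A : Set} → A → List A → A
end x []       = x
end x (y ∷ ys) = end y ys

end∈ : ∀ {A : Set} (x : A) y ys → end x (y ∷ ys) ∈ y ∷ ys
end∈ x y []       = here refl
end∈ x y (z ∷ zs) = there (end∈ y z zs)

drop-end : ∀ {A : Set} (x : A) xs → drop (length xs) (x ∷ xs) ≡ [ end x xs ]
drop-end x []       = refl
drop-end x (y ∷ xs) = drop-end y xs

-- Bookkeeping for two walks from `x` that are joined into one by reversing the first.
ʳ++-end : ∀ {A : Set} (x : A) ps ys → ∃ λ qs → ps ʳ++ (x ∷ ys) ≡ end x ps ∷ qs ×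
          length qs ≡ length ps + length ys × end (end x ps) qs ≡ end x ys
ʳ++-end x []       ys = ys , refl , refl , refl
ʳ++-end x (p ∷ ps) ys =
  let qs , e , len , en = ʳ++-end p ps (x ∷ ys) in
  qs , e , trans len (+-suc (length ps) (length ys)) , en

module _ {A : Set} where

  _≢head_ : A → List A → Set
  x ≢head []      = ⊤
  x ≢head (y ∷ _) = x ≢ y

  HeadsDiffer : List A → List A → Set
  HeadsDiffer []      ys = ⊤
  HeadsDiffer (x ∷ _) ys = x ≢head ys

module _ (G : Graph n) where

  infixr 5 _⟨_⟩∷_

  -- NB xs: the vertex sequence xs is a non-backtracking walk.
  data NB : List (Fin n) → Set where
    []  : NB []
    [-] : ∀ {x} → NB (x ∷ [])
    _⟨_⟩∷_ : ∀ {x y zs} → Adj G x y → x ≢head zs → NB (y ∷ zs) → NB (x ∷ y ∷ zs)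

  nb? : ∀ xs → Dec (NB xs)
  nb? []           = yes []
  nb? (x ∷ [])     = yes [-]
  nb? (x ∷ y ∷ zs) = map′ (λ (a , h , w) → a ⟨ h ⟩∷ w) (λ { (a ⟨ h ⟩∷ w) → a , h , w })
                          (adj? G x y ×-dec ≢head? zs ×-dec nb? (y ∷ zs))
    where
    ≢head? : ∀ zs → Dec (x ≢head zs)
    ≢head? []      = yes _
    ≢head? (z ∷ _) = ¬? (x ≟ᶠ z)

  NB⇒Linked : ∀ {xs} → NB xs → Linked (Adj G) xs
  NB⇒Linked []          = []
  NB⇒Linked [-]         = [-]
  NB⇒Linked (a ⟨ _ ⟩∷ w) = a ∷ NB⇒Linked w

  NB-tail : ∀ {x xs} → NB (x ∷ xs) → NB xs
  NB-tail [-]         = []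
  NB-tail (_ ⟨ _ ⟩∷ w) = w

  -- The first walk is run backwards to `u` and continued along the second. The only new place where
  -- it could backtrack is `u`, which `HeadsDiffer` excludes.
  NB-glue : ∀ {u xs ys} → NB (u ∷ xs) → NB (u ∷ ys) → HeadsDiffer xs ys → NB (xs ʳ++ (u ∷ ys))
  NB-glue [-]                          w' d = w'
  NB-glue (a ⟨ _ ⟩∷ [-])               w' d = Adj-sym G a ⟨ d ⟩∷ w'
  NB-glue (a ⟨ h ⟩∷ w@(_ ⟨ _ ⟩∷ _))    w' d = NB-glue w (Adj-sym G a ⟨ d ⟩∷ w') (h ∘ sym)

  -- The case distinction on `xs` only lets the `≢head` conditions compute.
  NB-∷ʳ : ∀ {xs a b c} → NB (xs ∷ʳ a ∷ʳ b) → Adj G b c → a ≢ c → NB (xs ∷ʳ a ∷ʳ b ∷ʳ c)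
  NB-∷ʳ {[]}         (e ⟨ h ⟩∷ w) bc a≢c = e ⟨ a≢c ⟩∷ bc ⟨ _ ⟩∷ [-]
  NB-∷ʳ {x ∷ []}     (e ⟨ h ⟩∷ w) bc a≢c = e ⟨ h ⟩∷ NB-∷ʳ {[]} w bc a≢c
  NB-∷ʳ {x ∷ y ∷ []} (e ⟨ h ⟩∷ w) bc a≢c = e ⟨ h ⟩∷ NB-∷ʳ {y ∷ []} w bc a≢c
  NB-∷ʳ {x ∷ y ∷ z ∷ xs} (e ⟨ h ⟩∷ w) bc a≢c = e ⟨ h ⟩∷ NB-∷ʳ {y ∷ z ∷ xs} w bc a≢c

  -- If the girth exceeds 2l and s is at most l, this says that the distance is exactly s; see
  -- `Reaches-length-unique`.
  Reaches : ℕ → Fin n → Fin n → Set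
  Reaches s x v = ∃ λ ps → length ps ≡ s × NB (x ∷ ps) × end x ps ≡ v

  reaches? : ∀ s x v → Dec (Reaches s x v)
  reaches? s x v = map′ to from
    (∃? {xs = vectors (allFin n) s} (∈-vectors ∈-allFin) λ ps → nb? (x ∷ toList ps) ×-dec (end x (toList ps) ≟ᶠ v))
    where
    to : (∃ λ (ps : Vec (Fin n) s) → NB (x ∷ toList ps) × end x (toList ps) ≡ v) → Reaches s x v
    to (ps , w , e) = toList ps , length-toList ps , w , e
    from : Reaches s x v → ∃ λ (ps : Vec (Fin n) s) → NB (x ∷ toList ps) × end x (toList ps) ≡ v
    from (ps , refl , w , e) = fromList ps , subst (λ qs → NB (x ∷ qs) × end x qs ≡ v) (sym (toList∘fromList ps)) (w , e)

  Reaches-sym : ∀ {s x v} → Reaches s x v → Reaches s v x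
  Reaches-sym {x = x} (ps , refl , w , refl) =
    let qs , e , len , en = ʳ++-end x ps [] in
    qs , trans len (+-identityʳ _) , subst NB e (NB-glue w [-] (differ[] ps)) , en
    where
    differ[] : ∀ xs → HeadsDiffer {Fin n} xs []
    differ[] []      = _
    differ[] (_ ∷ _) = _

  Reaches-suffix : ∀ {x ps z} → NB (x ∷ ps) → z ∈ ps → ∃ λ s → s < length ps × Reaches s z (end x ps)
  Reaches-suffix {ps = z ∷ ps} w (here refl) = length ps , ≤-refl , ps , refl , NB-tail w , refl
  Reaches-suffix {ps = y ∷ ps} w (there p)   =
    let s , lt , r = Reaches-suffix (NB-tail w) p in s , m≤n⇒m≤1+n lt , r

  cycle-isCopy : ∀ {x zs} → Linked (Adj G) (x ∷ zs ∷ʳ x) → Unique (x ∷ zs) → ∃ (IsCopy (C (suc (length zs))) G)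
  cycle-isCopy {x} {zs} l u =
    image (C _) φ , image-isCopy (C _) φ (Unique⇒lookup-injective u) {G} λ i j a →
      case Adj-C⁻ {i = i} {j} a of λ where
        (inj₁ p) → along {i} {j} p
        (inj₂ p) → Adj-sym G (along {j} {i} p)
    where
    φ = fromList (x ∷ zs)
    along : ∀ {i j} → i ↝ j → Adj G (Vec.lookup φ i) (Vec.lookup φ j)
    along {i} {j}    (inj₁ e)       = proj₁ (Linked-lookup {xs = x ∷ zs} l i) j e
    along {i} {zero} (inj₂ (e , _)) = proj₂ (Linked-lookup {xs = x ∷ zs} l i) e

  -- A repetition in a non-backtracking walk closes a cycle no longer than the walk.
  module Girth (g : ℕ) (girth : ∀ {m} → 3 ≤ m → m ≤ g → ¬ ∃ (IsCopy (C m) G)) where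

    open DecMembership (_≟ᶠ_ {n}) using (_∈?_)

    NB⇒Unique : ∀ {xs} → NB xs → length xs ≤ suc g → Unique xs
    NB⇒Unique {[]}     w len = []
    NB⇒Unique {x ∷ xs} w len with x ∈? xs | NB⇒Unique (NB-tail w) (<⇒≤ len)
    ... | no x∉ | u = All.tabulate (λ z∈ x≡z → x∉ (subst (_∈ xs) (sym x≡z) z∈)) ∷ u
    -- The walk from `x` to its next occurrence has no other repetition, because the tail has none.
    -- It is a cycle: length 1 would be a loop and length 2 a backtracking.
    ... | yes x∈ | u with ys , zs , refl ← ∈-∃++ x∈ =
      contradiction (cycle-isCopy (Linked-prefix (x ∷ ys) (NB⇒Linked w)) (Unique-prefix {xs = ys} u))
                    (girth (long ys w) short)
      where
      long : ∀ ys {zs} → NB (x ∷ ys ++ x ∷ zs) → 3 ≤ suc (length ys)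
      long []           (a ⟨ _ ⟩∷ _) = contradiction a (Adj-irrefl G)
      long (y ∷ [])     (_ ⟨ h ⟩∷ _) = contradiction refl h
      long (y ∷ z ∷ ys) _           = s≤s (s≤s (s≤s z≤n))
      short : suc (length ys) ≤ g
      short = ≤-trans (≤-trans (s≤s (m≤m+n _ (length zs))) (≤-reflexive (trans (sym (+-suc (length ys) _)) (sym (length-++ ys))))) (s≤s⁻¹ len)

    NB-not-closed : ∀ {x xs} → NB (x ∷ xs) → length xs ≤ g → end x xs ≡ x → xs ≡ []
    NB-not-closed {xs = []}     w len e = refl
    NB-not-closed {x} {y ∷ ys} w len e with a ∷ _ ← NB⇒Unique w (s≤s len) =
      contradiction (sym e) (All.lookup a (end∈ x y ys))

    -- Common first vertices are cancelled. Once the walks separate, the reverse of one followed by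
    -- the other is a closed non-backtracking walk of length at most `g`, which is impossible.
    NB-path-unique : ∀ {x xs ys} → NB (x ∷ xs) → NB (x ∷ ys) → end x xs ≡ end x ys → length xs + length ys ≤ g → xs ≡ ys
    NB-path-unique {xs = []} w w' e len = sym (NB-not-closed w' len (sym e))
    NB-path-unique {xs = x' ∷ xs} {[]} w w' e len = NB-not-closed w (≤-trans (m≤m+n _ 0) len) e
    NB-path-unique {x} {x' ∷ xs} {y' ∷ ys} w w' e len with x' ≟ᶠ y'
    ... | yes refl = cong (x' ∷_) (NB-path-unique (NB-tail w) (NB-tail w') e
                       (≤-trans (+-mono-≤ (n≤1+n (length xs)) (n≤1+n (length ys))) len))
    ... | no x'≢y' with qs , eq , lq , en ← ʳ++-end x (x' ∷ xs) (y' ∷ ys)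
                   with refl ← NB-not-closed (subst NB eq (NB-glue w w' x'≢y')) (≤-trans (≤-reflexive lq) len) (trans en (sym e))
                   with () ← lq

    Reaches-length-unique : ∀ {s t x v} → Reaches s x v → Reaches t x v → s + t ≤ g → s ≡ t
    Reaches-length-unique (ps , refl , w , e) (qs , refl , w' , e') len =
      cong length (NB-path-unique w w' (trans e (sym e')) len)

  -- Two walks p ∷ P and x ∷ X which meet first at distance j + 1, joined at the meeting point.
  NB-join : ∀ j {p x P X} → NB (p ∷ P) → NB (x ∷ X) → length P ≡ length X → j < length P →
            drop j P ≡ drop j X → drop j (p ∷ P) ≢ drop j (x ∷ X) →
            ∃ λ I → length I ≡ suc (2 * j) × NB (p ∷ I ∷ʳ x) × All (λ z → z ∈ P ⊎ z ∈ X) I ×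
              (∃ λ u → ∃ λ P' → ∃ λ I' → P ≡ u ∷ P' × I ≡ u ∷ I') ×
              (∃ λ w → ∃ λ X' → ∃ λ I' → X ≡ w ∷ X' × I ≡ I' ∷ʳ w)
  NB-join zero {P = u ∷ P} w w' len lt refl ne
    with a ⟨ _ ⟩∷ _ ← w | b ⟨ _ ⟩∷ _ ← w' =
    [ u ] , refl , a ⟨ (λ { refl → ne refl }) ⟩∷ (Adj-sym G b ⟨ _ ⟩∷ [-]) , inj₁ (here refl) ∷ [] ,
    (u , P , [] , refl , refl) , (u , P , [] , refl , refl)
  NB-join (suc j) {p} {x} {p' ∷ P} {x' ∷ X} w w' len lt eq ne
    with I , lI , wI , aI , (u , P' , I' , refl , e₁) , (v , X' , I'' , refl , e₂) ←
      NB-join j (NB-tail w) (NB-tail w') (suc-injective len) (s≤s⁻¹ lt) eq ne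
    with a ⟨ h ⟩∷ _ ← w | b ⟨ h' ⟩∷ _ ← w' =
    p' ∷ I ∷ʳ x' , len' , a ⟨ subst (λ J → p ≢head (J ∷ʳ x' ∷ʳ x)) (sym e₁) h ⟩∷ nb ,
    inj₁ (here refl) ∷ All.++⁺ (All.map (λ { (inj₁ q) → inj₁ (there q) ; (inj₂ q) → inj₂ (there q) }) aI) (inj₂ (here refl) ∷ []) ,
    (p' , _ , _ , refl , refl) , (x' , _ , p' ∷ I , refl , refl)
    where
    nb : NB (p' ∷ I ∷ʳ x' ∷ʳ x)
    nb = subst (λ J → NB (p' ∷ J ∷ʳ x' ∷ʳ x)) (sym e₂)
           (NB-∷ʳ {p' ∷ I''} (subst (λ J → NB (p' ∷ J ∷ʳ x')) e₂ wI) (Adj-sym G b) (h' ∘ sym))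
    len' : length (p' ∷ I ∷ʳ x') ≡ suc (2 * suc j)
    len' = cong suc (trans (length-++ I) (trans (cong (_+ 1) lI) (lem j)))
      where
      lem : ∀ j → suc (2 * j) + 1 ≡ 2 * suc j
      lem = solve-∀

-- The graph between two sets of vertices far from a root

Linked-∷ʳ : ∀ {A : Set} {R : Rel A 0ℓ} {x z} xs → Linked R (x ∷ xs) → R (end x xs) z → Linked R (x ∷ xs ∷ʳ z)
Linked-∷ʳ []       [-]     r = r ∷ [-]
Linked-∷ʳ (y ∷ xs) (a ∷ l) r = a ∷ Linked-∷ʳ xs l r

private
  join-length : ∀ j → suc (2 * j) + 1 ≡ 2 * suc j
  join-length = solve-∀
  cycle-length : ∀ i j → 2 + (2 * j + (2 + 2 * i)) ≡ 2 * (i + j + 2)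
  cycle-length = solve-∀
  avoided-length : ∀ i → 5 + 2 * i ≡ 2 * suc i + 3
  avoided-length = solve-∀

module Core {n : ℕ} (G : Graph n) (k l : ℕ) (l<k : l < k)
  (girth : ∀ {m} → 3 ≤ m → m ≤ 2 * l → ¬ ∃ (IsCopy (C m) G))
  (noC₂ₖ : ¬ ∃ (IsCopy (C (2 * k)) G)) where

  open Girth G (2 * l) girth

  private
    V : Set
    V = Fin n

  -- Vertices with more than `D` neighbours on the other side leave a choice when an alternating
  -- path is extended: at most 2k + 3 vertices have to be avoided.
  D : ℕ
  D = 2 * k + 3

  module _ (v : V) (path : V → List V) where

    Rooted : V → Set
    Rooted x = NB G (x ∷ path x) × end x (path x) ≡ v × length (path x) ≡ l

    -- Keeps such vertices off the paths to the root, on which every vertex after the first is at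
    -- distance less than `l` from `v`.
    Remote : V → Set
    Remote z = ∀ {s} → s < l → ¬ Reaches G s z v

    -- The ancestors of `x` from height `j` on, with `x` at height 0. Whole lists are compared, so
    -- agreement at one height includes all greater heights, as `NB-join` requires.
    up : ℕ → V → List V
    up j x = drop j (x ∷ path x)

    -- The forbidden cycle rises from `p` to the meeting point at height j + 1, descends to `x`,
    -- follows `t` and returns to `p`: 2(j + 1) + (2i + 1) + 1 = 2k edges.
    close : ∀ {i j p x t} → k ≡ i + j + 2 → suc j ≤ l → Rooted p → Rooted x →
            up (suc j) p ≡ up (suc j) x → up j p ≢ up j x →
            Linked (Adj G) (x ∷ t) → Unique (x ∷ t) → All Remote t → p ∉ x ∷ t →
            Adj G (end x t) p → length t ≡ suc (2 * i) → ⊥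
    close {i} {j} {p} {x} {t} refl j<l (wp , ep , lp) (wx , ex , lx) eq ne lt ut rt p∉ a len =
      let I , lI , wI , aI , _ = NB-join G j wp wx (trans lp (sym lx)) (subst (j <_) (sym lp) j<l) eq ne
          near : ∀ {z} → z ∈ I → ∃ λ s → s < l × Reaches G s z v
          near z∈ = case All.lookup aI z∈ of λ where
            (inj₁ z∈P) → let s , s< , r = Reaches-suffix G wp z∈P in s , subst (s <_) lp s< , subst (Reaches G s _) ep r
            (inj₂ z∈X) → let s , s< , r = Reaches-suffix G wx z∈X in s , subst (s <_) lx s< , subst (Reaches G s _) ex r
          -- This part has length 2(j + 1), at most 2l, so the girth forbids repetitions.
          uI : Unique (p ∷ I ∷ʳ x)
          uI = NB⇒Unique wI (≤-trans (≤-reflexive (cong suc (trans (trans (length-++ I) (cong (_+ 1) lI)) (join-length j))))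
                                     (s≤s (*-monoʳ-≤ 2 j<l)))
          disjoint : ∀ {z} → z ∈ p ∷ I ∷ʳ x × z ∈ t → ⊥
          disjoint = λ where
            (here refl , z∈t) → p∉ (there z∈t)
            (there z∈ , z∈t) → case ∈-++⁻ I z∈ of λ where
              (inj₁ z∈I) → let s , s<l , r = near z∈I in All.lookup rt z∈t s<l r
              (inj₂ (here refl)) → fresh ut z∈t
          cyc = cycle-isCopy G {p} {I ++ x ∷ t}
            (subst (λ J → Linked (Adj G) (p ∷ J)) (sym (++-assoc I (x ∷ t) [ p ]))
              (Linked-join (p ∷ I) (NB⇒Linked G wI) (Linked-∷ʳ t lt a)))
            (subst Unique (cong (p ∷_) (++-assoc I [ x ] t)) (++⁺ uI (tailᵘ ut) disjoint))
      in noC₂ₖ (subst (λ m → ∃ (IsCopy (C m) G))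
                 (trans (cong suc (trans (length-++ I) (cong₂ (λ a b → a + suc b) lI len))) (cycle-length i j)) cyc)
      where
      fresh : ∀ {z zs} → Unique (z ∷ zs) → z ∉ zs
      fresh (a ∷ _) z∈ = All.lookup a z∈ refl
      tailᵘ : ∀ {z : V} {zs} → Unique (z ∷ zs) → Unique zs
      tailᵘ (_ ∷ u) = u

    module Dense {L R : List V} (uL : Unique L) (uR : Unique R)
      (rooted : ∀ {x} → x ∈ L → Rooted x)
      (remoteL : ∀ {x} → x ∈ L → Remote x) (remoteR : ∀ {y} → y ∈ R → Remote y)
      (degL : ∀ {x} → x ∈ L → D < ∑[ y ∈ R ] 𝟙 (adj? G x y))
      (degR : ∀ {y} → y ∈ R → D < ∑[ x ∈ L ] 𝟙 (adj? G x y)) where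

      nbrR : ∀ {x} → x ∈ L → ∀ zs → length zs ≤ D → ∃ λ y → y ∈ R × Adj G x y × y ∉ zs
      nbrR {x} x∈ zs len = filter-escape (adj? G x) _≟ᶠ_ zs uR (≤-<-trans len (degL x∈))

      nbrL : ∀ {y} → y ∈ R → ∀ zs → length zs ≤ D → ∃ λ x → x ∈ L × Adj G x y × x ∉ zs
      nbrL {y} y∈ zs len = filter-escape (λ x → adj? G x y) _≟ᶠ_ zs uL (≤-<-trans len (degR y∈))

      -- True at height `l`, where only the root is left. It is brought down to height 0, where it
      -- makes all neighbours in `L` of a vertex of `R` equal, contrary to their number.
      Agree : ℕ → Set
      Agree j = ∀ {y p q} → y ∈ R → p ∈ L → q ∈ L → Adj G p y → Adj G q y → up j p ≡ up j q

      -- A path of length 2i + 1 alternating between `L` and `R`, grown backwards from the edge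
      -- between `b` and `y`. Consecutive vertices of `L` share a neighbour in `R`, so `Agree j`
      -- carries the ancestors of `b` to the other end `x`.
      record Zigzag (i j : ℕ) (b y p q : V) : Set where
        field
          {x}    : V
          {t}    : List V
          x∈     : x ∈ L
          linked : Linked (Adj G) (x ∷ t)
          unique : Unique (x ∷ t)
          remote : All Remote t
          p∉     : p ∉ x ∷ t
          q∉     : q ∉ x ∷ t
          end≡   : end x t ≡ y
          len    : length t ≡ suc (2 * i)
          up≡    : up j x ≡ up j b

      zigzag : ∀ {i j b y p q} → Agree j → i ≤ k → b ∈ L → y ∈ R → Adj G b y → b ≢ p → b ≢ q → Adj G p y → Adj G q y → Zigzag i j b y p q
      zigzag {zero} _ _ b∈ y∈ a b≢p b≢q ap aq = record
        { x∈ = b∈ ; linked = a ∷ [-] ; unique = (Adj-≢ G a ∷ []) ∷ [] ∷ [] ; remote = remoteR y∈ ∷ []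
        ; p∉ = λ { (here e) → b≢p (sym e) ; (there (here refl)) → Adj-irrefl G ap }
        ; q∉ = λ { (here e) → b≢q (sym e) ; (there (here refl)) → Adj-irrefl G aq }
        ; end≡ = refl ; len = refl ; up≡ = refl }
      zigzag {suc i} {j} {b} {y} {p} {q} agree i<k b∈ y∈ a b≢p b≢q ap aq =
        let y' , y'∈ , xy' , y'∉ = nbrR x∈ (p ∷ q ∷ x ∷ t) short
            x' , x'∈ , x'y' , x'∉ = nbrL y'∈ (p ∷ q ∷ y' ∷ x ∷ t) short'
        in record
        { x∈ = x'∈
        ; linked = x'y' ∷ Adj-sym G xy' ∷ linked
        ; unique = All.tabulate (λ z∈ e → x'∉ (there (there (subst (_∈ _) (sym e) z∈))))
                 ∷ All.tabulate (λ z∈ e → y'∉ (there (there (subst (_∈ _) (sym e) z∈)))) ∷ unique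
        ; remote = remoteR y'∈ ∷ remoteL x∈ ∷ remote
        ; p∉ = λ { (here e) → x'∉ (here (sym e)) ; (there (here e)) → y'∉ (here (sym e)) ; (there (there p∈)) → p∉ p∈ }
        ; q∉ = λ { (here e) → x'∉ (there (here (sym e))) ; (there (here e)) → y'∉ (there (here (sym e))) ; (there (there q∈)) → q∉ q∈ }
        ; end≡ = end≡
        ; len = trans (cong (2 +_) len) (cong suc (sym (*-suc 2 i)))
        ; up≡ = trans (agree y'∈ x'∈ x∈ x'y' xy') up≡ }
        where
        open Zigzag (zigzag {i} {j} agree (<⇒≤ i<k) b∈ y∈ a b≢p b≢q ap aq)
        -- Only the length matters, so the first `x` stands for `y'`, which is not in scope here.
        short' : length (p ∷ q ∷ x ∷ x ∷ t) ≤ D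
        short' rewrite len = ≤-trans (≤-trans (≤-reflexive (avoided-length i)) (+-monoˡ-≤ 3 (*-monoʳ-≤ 2 i<k))) ≤-refl
        short : length (p ∷ q ∷ x ∷ t) ≤ D
        short = <⇒≤ short'

      -- If p and q differ at height j, then the end x of a zigzag of length 2 (k - j - 2) from a third
      -- neighbour b differs there from p or q, but has the same ancestors above.  The zigzag and the
      -- walk from x up to height j + 1 and down to that neighbour of y form a C₂ₖ.
      agree-step : ∀ j → suc j ≤ l → Agree (suc j) → Agree j
      agree-step j j<l agree {y} {p} {q} y∈ p∈ q∈ ap aq with ≡-dec _≟ᶠ_ (up j p) (up j q)
      ... | yes e = e
      ... | no ne = ⊥-elim (case ≡-dec _≟ᶠ_ (up j p) (up j x) of λ where
              (yes e) → finish q∈ q∉ aq (λ e' → ne (trans e (sym e')))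
              (no ne') → finish p∈ p∉ ap ne')
        where
        third = nbrL y∈ (p ∷ q ∷ []) (≤-trans (n≤1+n 2) (m≤n+m 3 (2 * k)))
        b = proj₁ third
        b∈ = proj₁ (proj₂ third)
        ab = proj₁ (proj₂ (proj₂ third))
        b∉ = proj₂ (proj₂ (proj₂ third))
        i = k ∸ (j + 2)
        k≡ : k ≡ i + j + 2
        -- The inequality l < k enters here: it gives j + 2 ≤ k, so the zigzag has a length that
        -- completes the cycle.
        k≡ = trans (sym (m∸n+n≡m (≤-trans (≤-reflexive (+-comm j 2)) (≤-trans (s≤s j<l) l<k)))) (sym (+-assoc i j 2))
        open Zigzag (zigzag {i} {suc j} agree (m∸n≤m k (j + 2)) b∈ y∈ ab (b∉ ∘ here) (b∉ ∘ there ∘ here) ap aq)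
        finish : ∀ {r} → r ∈ L → r ∉ x ∷ t → Adj G r y → up j r ≢ up j x → ⊥
        finish {r} r∈ r∉ ar ne = close {i} {j} k≡ j<l (rooted r∈) (rooted x∈)
          (trans (agree y∈ r∈ b∈ ar ab) (sym up≡)) ne linked unique remote r∉
          (subst (λ z → Adj G z r) (sym end≡) (Adj-sym G ar)) len

      agree-l : Agree l
      agree-l {p = p} {q} y∈ p∈ q∈ _ _ = trans (top p∈) (sym (top q∈))
        where
        top : ∀ {x} → x ∈ L → up l x ≡ [ v ]
        top {x} x∈ with _ , e , len ← rooted x∈ = trans (cong (λ d → drop d (x ∷ path x)) (sym len)) (trans (drop-end x (path x)) (cong [_] e))

      agree : ∀ d j → j + d ≡ l → Agree j
      agree zero    j e = subst Agree (trans (sym e) (+-identityʳ j)) agree-l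
      agree (suc d) j e    = agree-step j (subst (suc j ≤_) e (≤-trans (s≤s (m≤m+n j d)) (≤-reflexive (sym (+-suc j d)))))
                               (agree d (suc j) (trans (sym (+-suc j d)) e))

      L-empty : ∀ {x} → x ∉ L
      L-empty x∈ =
        let y , y∈ , _ = nbrR x∈ [] z≤n
            p , p∈ , ap , _ = nbrL y∈ [] z≤n
            q , q∈ , aq , q∉ = nbrL y∈ [ p ] (≤-trans (m≤m+n 1 2) (m≤n+m 3 (2 * k)))
        in q∉ (here (sym (∷-injectiveˡ (agree l 0 refl y∈ p∈ q∈ ap aq))))

    -- Vertices with few neighbours are removed until the remaining sets are dense, hence empty.
    edges-bound : ∀ {s} (L R : List V) → length L + length R ≤ s → Unique L → Unique R →
      (∀ {x} → x ∈ L → Rooted x) → (∀ {x} → x ∈ L → Remote x) → (∀ {y} → y ∈ R → Remote y) →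
      ∑[ x ∈ L ] ∑[ y ∈ R ] 𝟙 (adj? G x y) ≤ D * (length L + length R)
    edges-bound {s} L R bound uL uR rooted rL rR
      with Any.any? (λ x → ∑[ y ∈ R ] 𝟙 (adj? G x y) ≤? D) L
         | Any.any? (λ y → ∑[ x ∈ L ] 𝟙 (adj? G x y) ≤? D) R
    edges-bound {zero} [] R _ uL uR rooted rL rR | yes () | _
    edges-bound {suc s} L R bound uL uR rooted rL rR | yes h | _ =
      let x , x∈ , few = find h
          L' = L ─ x∈
          len = length-─ x∈
      in begin
        ∑[ x ∈ L ] ∑[ y ∈ R ] 𝟙 (adj? G x y)
          ≡⟨ ∑-remove (λ x → ∑[ y ∈ R ] 𝟙 (adj? G x y)) x∈ ⟩
        (∑[ y ∈ R ] 𝟙 (adj? G x y)) + (∑[ x ∈ L' ] ∑[ y ∈ R ] 𝟙 (adj? G x y))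
          ≤⟨ +-mono-≤ few (edges-bound {s} L' R (s≤s⁻¹ (subst (λ a → a + length R ≤ suc s) len bound)) (Unique-─ x∈ uL) uR
               (rooted ∘ ∈-─⁻ x∈) (rL ∘ ∈-─⁻ x∈) rR) ⟩
        D + D * (length L' + length R)
          ≡⟨ *-suc D _ ⟨
        D * suc (length L' + length R)
          ≡⟨ cong (λ a → D * (a + length R)) len ⟨
        D * (length L + length R) ∎
      where open ≤-Reasoning
    edges-bound {zero} L@[] R _ uL uR rooted rL rR | no _ | _ = z≤n
    edges-bound {suc s} L R bound uL uR rooted rL rR | no _ | yes h =
      let y , y∈ , few = find h
          R' = R ─ y∈
          len = length-─ y∈
      in begin
        ∑[ x ∈ L ] ∑[ y ∈ R ] 𝟙 (adj? G x y)
          ≡⟨ ∑-swap L R _ ⟩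
        ∑[ y ∈ R ] ∑[ x ∈ L ] 𝟙 (adj? G x y)
          ≡⟨ ∑-remove (λ y → ∑[ x ∈ L ] 𝟙 (adj? G x y)) y∈ ⟩
        (∑[ x ∈ L ] 𝟙 (adj? G x y)) + (∑[ y ∈ R' ] ∑[ x ∈ L ] 𝟙 (adj? G x y))
          ≡⟨ cong ((∑[ x ∈ L ] 𝟙 (adj? G x y)) +_) (∑-swap R' L _) ⟩
        (∑[ x ∈ L ] 𝟙 (adj? G x y)) + (∑[ x ∈ L ] ∑[ y ∈ R' ] 𝟙 (adj? G x y))
          ≤⟨ +-mono-≤ few (edges-bound {s} L R' (s≤s⁻¹ (subst (_≤ suc s) (trans (cong (length L +_) len) (+-suc (length L) _)) bound))
               uL (Unique-─ y∈ uR) rooted rL (rR ∘ ∈-─⁻ y∈)) ⟩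
        D + D * (length L + length R')
          ≡⟨ *-suc D _ ⟨
        D * suc (length L + length R')
          ≡⟨ cong (D *_) (trans (cong (length L +_) len) (+-suc (length L) _)) ⟨
        D * (length L + length R) ∎
      where open ≤-Reasoning
    edges-bound [] R bound uL uR rooted rL rR | no _ | no _ = z≤n
    edges-bound L@(_ ∷ _) R bound uL uR rooted rL rR | no ¬h | no ¬h' =
      ⊥-elim (Dense.L-empty uL uR rooted rL rR (λ x∈ → ≰⇒> λ le → ¬h (lose x∈ le)) (λ y∈ → ≰⇒> λ le → ¬h' (lose y∈ le)) (here refl))

-- The upper bound

∸-step : ∀ {t a} → t < a → a ∸ t ≡ suc (a ∸ suc t)
∸-step {zero}  (s≤s _) = refl
∸-step {suc t} (s≤s p) = ∸-step p

applyUpTo-≡ : ∀ {A : Set} {f g : ℕ → A} s → applyUpTo f s ≡ applyUpTo g s → ∀ {t} → t < s → f t ≡ g t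
applyUpTo-≡ (suc s) e {zero}  _       = ∷-injectiveˡ e
applyUpTo-≡ (suc s) e {suc t} (s≤s p) = applyUpTo-≡ s (∷-injectiveʳ e) p

end-applyUpTo : ∀ {A : Set} (f : ℕ → A) s → end (f 0) (applyUpTo (f ∘ suc) s) ≡ f s
end-applyUpTo f zero    = refl
end-applyUpTo f (suc s) = end-applyUpTo (f ∘ suc) s

module _ (G : Graph n) where

  NB-applyUpTo : ∀ s (f : ℕ → Fin n) → (∀ {t} → t < s → Adj G (f t) (f (suc t))) →
                 (∀ {t} → suc t < s → f t ≢ f (2 + t)) → NB G (f 0 ∷ applyUpTo (f ∘ suc) s)
  NB-applyUpTo zero    f a d = [-]
  NB-applyUpTo (suc s) f a d = a (s≤s z≤n) ⟨ first s d ⟩∷ NB-applyUpTo s (f ∘ suc) (a ∘ s≤s) (d ∘ s≤s)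
    where
    first : ∀ s → (∀ {t} → suc t < suc s → f t ≢ f (2 + t)) → f 0 ≢head applyUpTo (λ t → f (2 + t)) s
    first zero    d = _
    first (suc s) d = d (s≤s (s≤s z≤n))

  Cycle-mod : ∀ {m} (c : Cycle G m) r q → Cycle.ψ c (r + q * m) ≡ Cycle.ψ c r
  Cycle-mod c r zero    = cong (Cycle.ψ c) (+-identityʳ r)
  Cycle-mod {m} c r (suc q) =
    trans (cong ψ (trans (cong (r +_) (+-comm m (q * m))) (sym (+-assoc r (q * m) m))))
          (trans (periodic (r + q * m)) (Cycle-mod c r q))
    where open Cycle c

  Cycle-% : ∀ {m} .{{_ : NonZero m}} (c : Cycle G m) t → Cycle.ψ c t ≡ Cycle.ψ c (t % m)
  Cycle-% {m} c t = trans (cong (Cycle.ψ c) (m≡m%n+[m/n]*n t m)) (Cycle-mod c (t % m) (t / m))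

module _ {h} {H : Graph h} {G : Graph n} where

  copy-⊆ : ∀ S S' {φ φ' : Vec (Fin n) h} → IsSubgraph G S → IsIsomorphism H S φ → IsIsomorphism H S' φ' →
           (∀ i → Vec.lookup φ i ≡ Vec.lookup φ' i) →
           (∀ {v} → v ∈ˢ proj₁ S → v ∈ˢ proj₁ S') × (∀ {u v} → Adj (proj₂ S) u v → Adj (proj₂ S') u v)
  copy-⊆ (W , E) (W' , E') sub (_ , vs , es) (_ , vs' , es') eq =
    (λ {v} v∈ → let i , e = Equivalence.to (vs v) v∈ in Equivalence.from (vs' v) (i , trans (sym (eq i)) e)) ,
    λ {u} {v} a →
      let _ , u∈ , v∈ = sub u v a
          i , p = Equivalence.to (vs u) u∈
          j , q = Equivalence.to (vs v) v∈
      in subst₂ (Adj E') (trans (sym (eq i)) p) (trans (sym (eq j)) q)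
           (Equivalence.to (es' i j) (Equivalence.from (es i j) (subst₂ (Adj E) (sym p) (sym q) a)))

  -- The vertex set is the range of the table and the edge set is the image of the edges of `H`. By
  -- `Graph-ext`, equal adjacency gives equal terms.
  copy-determined : ∀ S S' {φ φ' : Vec (Fin n) h} → IsSubgraph G S → IsSubgraph G S' →
    IsIsomorphism H S φ → IsIsomorphism H S' φ' → (∀ i → Vec.lookup φ i ≡ Vec.lookup φ' i) → S ≡ S'
  copy-determined S S' {φ} {φ'} sub sub' iso iso' eq =
    cong₂ _,_ (⊆-antisym (proj₁ to) (proj₁ from))
              (Graph-ext (proj₂ S) (proj₂ S') λ u v → mk⇔ (proj₂ to) (proj₂ from))
    where
    to   = copy-⊆ S S' {φ} {φ'} sub iso iso' eq
    from = copy-⊆ S' S {φ'} {φ} sub' iso' iso (sym ∘ eq)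

Unique-subsets : ∀ n → Unique (subsets n)
Unique-subsets zero    = [] ∷ []
Unique-subsets (suc n) = cartesianProductWith⁺ _∷_ (λ { refl → refl , refl }) (((λ ()) ∷ []) ∷ [] ∷ []) (Unique-subsets n)

Unique-graphs : ∀ n → Unique (graphs n)
Unique-graphs zero    = [] ∷ []
Unique-graphs (suc n) = cartesianProductWith⁺ _∷_ (λ { refl → refl , refl }) (Unique-subsets n) (Unique-graphs n)

Unique-subgraphs : ∀ n → Unique (subgraphs n)
Unique-subgraphs n = cartesianProduct⁺ (Unique-subsets n) (Unique-graphs n)

-- Spheres around a root

module Upper {n : ℕ} (G : Graph n) (k l : ℕ) (l<k : l < k) (1≤l : 1 ≤ l)
  (girth : ∀ {m} → 3 ≤ m → m ≤ 2 * l → ¬ ∃ (IsCopy (C m) G))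
  (noC₂ₖ : ¬ ∃ (IsCopy (C (2 * k)) G)) where

  open Girth G (2 * l) girth
  open Core G k l l<k girth noC₂ₖ

  private
    V : List (Fin n)
    V = allFin n

    l+l≡2l : l + l ≡ 2 * l
    l+l≡2l = cong (l +_) (sym (+-identityʳ l))

  path : Fin n → Fin n → List (Fin n)
  path v x with reaches? G l x v
  ... | yes (ps , _) = ps
  -- A default value; `path-rooted` is applied only where the root is reached.
  ... | no _         = []

  path-rooted : ∀ {v x} → Reaches G l x v → Rooted v (path v) x
  path-rooted {v} {x} r with reaches? G l x v
  ... | yes (ps , len , w , e) = w , e , len
  ... | no ¬r                  = contradiction r ¬r

  -- Walks of lengths s < l and l between the same ends have total length at most 2l, against
  -- `Reaches-length-unique`.
  reaches-remote : ∀ {v x} → Reaches G l x v → Remote v (path v) x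
  reaches-remote {v} {x} r s<l r' =
    <⇒≢ s<l (Reaches-length-unique r' r (≤-trans (+-monoˡ-≤ l (<⇒≤ s<l)) (≤-reflexive l+l≡2l)))

  edges-between : ∀ {v} L R → Unique L → Unique R → (∀ {x} → x ∈ L → Reaches G l x v) →
                  (∀ {y} → y ∈ R → Remote v (path v) y) →
                  ∑[ x ∈ L ] ∑[ y ∈ R ] 𝟙 (adj? G x y) ≤ D * (length L + length R)
  edges-between {v} L R uL uR rL rR =
    edges-bound v (path v) L R ≤-refl uL uR (path-rooted ∘ rL) (reaches-remote ∘ rL) rR

  sphere : Fin n → List (Fin n)
  sphere v = filter (λ x → reaches? G l x v) V

  near? : ∀ v z → Dec (∃ λ (s : Fin l) → Reaches G (toℕ s) z v)
  near? v z = any? λ s → reaches? G (toℕ s) z v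

  far : Fin n → List (Fin n)
  far v = filter (λ z → ¬? (near? v z)) V

  far-remote : ∀ {v z} → z ∈ far v → Remote v (path v) z
  far-remote {v} {z} z∈ s<l r = proj₂ (∈-filter⁻ (λ z → ¬? (near? v z)) {xs = V} z∈)
    (fromℕ< s<l , subst (λ s → Reaches G s z v) (sym (toℕ-fromℕ< s<l)) r)

  -- Only the first vertex of the walk from x to v is a neighbour of x near v.
  deg≤far : ∀ {v x} → Reaches G l x v → deg G x ≤ 1 + (∑[ w ∈ far v ] 𝟙 (adj? G x w))
  deg≤far {v} {x} ([] , refl , _) = contradiction 1≤l λ ()
  deg≤far {v} {x} (u ∷ ps , len , w , e) = begin
    deg G x                                                        ≤⟨ ∑-mono V (λ {y} _ → split y) ⟩
    ∑[ y ∈ V ] 𝟙 (u ≟ᶠ y) + 𝟙 (¬? (near? v y)) * 𝟙 (adj? G x y)    ≡⟨ ∑-distrib-+ V ⟩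
    (∑[ y ∈ V ] 𝟙 (u ≟ᶠ y)) + (∑[ y ∈ V ] 𝟙 (¬? (near? v y)) * 𝟙 (adj? G x y))
      ≤⟨ +-mono-≤ (∑-≟≤1 u) (≤-reflexive (sym (∑-filter (λ z → ¬? (near? v z)) V _))) ⟩
    1 + (∑[ y ∈ far v ] 𝟙 (adj? G x y)) ∎
    where
    open ≤-Reasoning
    split : ∀ y → 𝟙 (adj? G x y) ≤ 𝟙 (u ≟ᶠ y) + 𝟙 (¬? (near? v y)) * 𝟙 (adj? G x y)
    split y with adj? G x y | u ≟ᶠ y | near? v y
    ... | no _  | _     | _     = z≤n
    ... | yes _ | yes _ | _     = s≤s z≤n
    ... | yes _ | no _  | no _  = ≤-refl
    -- A second near neighbour `y` would reach `v` both in s < l steps and, through `x`, in l + 1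
    -- steps; the total is still at most 2l.
    ... | yes a | no u≢y | yes (s , r) = contradiction
          (Reaches-length-unique r (x ∷ u ∷ ps , cong suc len , Adj-sym G a ⟨ u≢y ∘ sym ⟩∷ w , e)
            (≤-trans (≤-reflexive (+-suc (toℕ s) l)) (≤-trans (+-monoˡ-≤ l (toℕ<n s)) (≤-reflexive l+l≡2l))))
          (<⇒≢ (m≤n⇒m≤1+n (toℕ<n s)))

  -- Each vertex of the sphere has at most one neighbour nearer to `v`. The remaining edges run
  -- between the sphere and `far v`, where `edges-between` gives a linear bound.
  sphere-degrees : ∀ v → ∑[ x ∈ sphere v ] deg G x ≤ (2 * D + 1) * n
  sphere-degrees v = begin
    ∑[ x ∈ sphere v ] deg G x
      ≤⟨ ∑-mono (sphere v) (λ x∈ → deg≤far (on x∈)) ⟩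
    ∑[ x ∈ sphere v ] (1 + (∑[ y ∈ far v ] 𝟙 (adj? G x y)))
      ≡⟨ ∑-distrib-+ (sphere v) ⟩
    (∑[ x ∈ sphere v ] 1) + (∑[ x ∈ sphere v ] ∑[ y ∈ far v ] 𝟙 (adj? G x y))
      ≤⟨ +-mono-≤ (≤-trans (≤-reflexive (trans (∑-const (sphere v) 1) (*-identityʳ _))) sphere≤n)
           (≤-trans (edges-between (sphere v) (far v) (filter⁺ _ (allFin⁺ n)) (filter⁺ _ (allFin⁺ n)) on far-remote)
                    (*-monoʳ-≤ D (+-mono-≤ sphere≤n (length-filter≤n _)))) ⟩
    n + D * (n + n)
      ≡⟨ lem n D ⟩
    (2 * D + 1) * n ∎
    where
    open ≤-Reasoning
    on : ∀ {x} → x ∈ sphere v → Reaches G l x v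
    on x∈ = proj₂ (∈-filter⁻ (λ x → reaches? G l x v) {xs = V} x∈)
    sphere≤n : length (sphere v) ≤ n
    sphere≤n = length-filter≤n (λ x → reaches? G l x v)
    lem : ∀ n d → n + d * (n + n) ≡ (2 * d + 1) * n
    lem = solve-∀

  -- Pairs of a root and an opposite vertex

  module Threshold (Δ : ℕ) (Δ^≤n : Δ ^ suc l ≤ n) where

    -- The degree condition is on the vertex being left, so at most Δ^s vertices are reached in s
    -- steps.
    _⇝_ : Fin n → Fin n → Set
    w ⇝ x = deg G w ≤ Δ × Adj G w x

    _⇝?_ : ∀ w x → Dec (w ⇝ x)
    w ⇝? x = (deg G w ≤? Δ) ×-dec adj? G w x

    ⇝-out : ∀ w → ∑[ x ∈ V ] 𝟙 (w ⇝? x) ≤ Δ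
    ⇝-out w = case deg G w ≤? Δ of λ where
        (yes le) → ≤-trans (∑-mono V λ {x} _ → 𝟙-mono (w ⇝? x) (adj? G w x) proj₂) le
        (no ¬le) → ≤-trans (∑-≤-const V {c = 0} (λ {x} _ → never ¬le x)) (≤-trans (≤-reflexive (*-zeroʳ (length V))) z≤n)
      where
      never : ¬ deg G w ≤ Δ → ∀ x → 𝟙 (w ⇝? x) ≤ 0
      never ¬le x with w ⇝? x
      ... | yes (le , _) = contradiction le ¬le
      ... | no _ = z≤n

    -- The root of a cycle is one of its vertices of degree more than Δ, if there is one.
    opposite? : ∀ v x → Dec (Reaches G l x v × (Δ < deg G v ⊎ Pow _⇝?_ l v x))
    opposite? v x = reaches? G l x v ×-dec ((Δ <? deg G v) ⊎-dec pow? _⇝?_ l v x)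

    opposite : Fin n → List (Fin n)
    opposite v = filter (opposite? v) V

    -- For a root of high degree, each opposite vertex is charged deg v instead of Δ. For the others
    -- there are at most Δ^l opposite vertices, and Δ^(l+1) ≤ n.
    opposite-bound : ∀ v → Δ * length (opposite v) ≤ (∑[ x ∈ V ] 𝟙 (reaches? G l x v) * deg G v) + n
    opposite-bound v = case Δ <? deg G v of λ where
        (yes high) → of-high high
        (no ¬high) → of-low ¬high
      where
      open ≤-Reasoning
      of-high : Δ < deg G v → Δ * length (opposite v) ≤ (∑[ x ∈ V ] 𝟙 (reaches? G l x v) * deg G v) + n
      of-high lt = ≤-trans (begin
        Δ * length (opposite v)                       ≤⟨ *-mono-≤ (<⇒≤ lt) (≤-reflexive (length-filter-∑ (opposite? v) V)) ⟩
        deg G v * (∑[ x ∈ V ] 𝟙 (opposite? v x))      ≤⟨ *-monoʳ-≤ (deg G v) (∑-mono V λ {x} _ → 𝟙-mono (opposite? v x) (reaches? G l x v) proj₁) ⟩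
        deg G v * (∑[ x ∈ V ] 𝟙 (reaches? G l x v))   ≡⟨ ∑-*ˡ V (deg G v) ⟨
        ∑[ x ∈ V ] deg G v * 𝟙 (reaches? G l x v)     ≤⟨ ∑-mono V (λ {x} _ → ≤-reflexive (*-comm (deg G v) _)) ⟩
        ∑[ x ∈ V ] 𝟙 (reaches? G l x v) * deg G v     ∎) (m≤m+n _ n)
      of-low : ¬ Δ < deg G v → Δ * length (opposite v) ≤ (∑[ x ∈ V ] 𝟙 (reaches? G l x v) * deg G v) + n
      of-low ¬lt = ≤-trans (begin
        Δ * length (opposite v)                       ≡⟨ cong (Δ *_) (length-filter-∑ (opposite? v) V) ⟩
        Δ * (∑[ x ∈ V ] 𝟙 (opposite? v x))            ≤⟨ *-monoʳ-≤ Δ (∑-mono V λ {x} _ → 𝟙-mono (opposite? v x) (pow? _⇝?_ l v x) low) ⟩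
        Δ * (∑[ x ∈ V ] 𝟙 (pow? _⇝?_ l v x))          ≤⟨ *-monoʳ-≤ Δ (pow-count _⇝?_ ⇝-out l v) ⟩
        Δ ^ suc l                                     ≤⟨ Δ^≤n ⟩
        n                                             ∎) (m≤n+m n _)
        where
        low : ∀ {x} → Reaches G l x v × (Δ < deg G v ⊎ Pow _⇝?_ l v x) → Pow _⇝?_ l v x
        low (_ , inj₁ lt) = contradiction lt ¬lt
        low (_ , inj₂ p)  = p

    -- The pairs at distance `l` are counted from the other end: for each `x`, the degrees of the
    -- roots on its sphere sum to O(n) by `sphere-degrees`.
    ∑-opposite : Δ * (∑[ v ∈ V ] length (opposite v)) ≤ (2 * D + 2) * (n * n)
    ∑-opposite = begin
      Δ * (∑[ v ∈ V ] length (opposite v))                                       ≡⟨ ∑-*ˡ V Δ ⟨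
      ∑[ v ∈ V ] Δ * length (opposite v)                                         ≤⟨ ∑-mono V (λ {v} _ → opposite-bound v) ⟩
      ∑[ v ∈ V ] ((∑[ x ∈ V ] 𝟙 (reaches? G l x v) * deg G v) + n)               ≡⟨ ∑-distrib-+ V ⟩
      (∑[ v ∈ V ] ∑[ x ∈ V ] 𝟙 (reaches? G l x v) * deg G v) + (∑[ v ∈ V ] n)    ≡⟨ cong₂ _+_ (∑-swap V V _) (∑-const V n) ⟩
      (∑[ x ∈ V ] ∑[ v ∈ V ] 𝟙 (reaches? G l x v) * deg G v) + length V * n
        ≤⟨ +-mono-≤ (∑-mono V (λ {x} _ → ∑-mono V λ {v} _ →
             *-monoˡ-≤ (deg G v) (𝟙-mono (reaches? G l x v) (reaches? G l v x) (Reaches-sym G)))) (≤-reflexive (cong (_* n) (length-allFin n))) ⟩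
      (∑[ x ∈ V ] ∑[ v ∈ V ] 𝟙 (reaches? G l v x) * deg G v) + n * n
        ≤⟨ +-monoˡ-≤ (n * n) (∑-≤-const V λ {x} _ → ≤-trans (≤-reflexive (sym (∑-filter (λ v → reaches? G l v x) V (deg G)))) (sphere-degrees x)) ⟩
      length V * ((2 * D + 1) * n) + n * n
        ≡⟨ cong (λ a → a * ((2 * D + 1) * n) + n * n) (length-allFin n) ⟩
      n * ((2 * D + 1) * n) + n * n
        ≡⟨ lem n D ⟩
      (2 * D + 2) * (n * n) ∎
      where
      open ≤-Reasoning
      lem : ∀ n d → n * ((2 * d + 1) * n) + n * n ≡ (2 * d + 2) * (n * n)
      lem = solve-∀

    -- Keys of cycles

    private
      N : ℕ
      N = suc (2 * l)

    -- The position of the root on the unrolled cycle, the root, and the two ends of the edge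
    -- opposite to it.
    Key : Set
    Key = Fin N × Fin n × Fin n × Fin n

    keys : List Key
    keys = concatMap (λ i → concatMap (λ v → concatMap (λ x →
      map (λ y → i , v , x , y) (filter (adj? G x) (opposite v))) (opposite v)) V) (allFin N)

    -- For a fixed root, the opposite edges lie within `opposite v`, so `edges-between` with this
    -- set on both sides bounds them linearly in its size.
    length-keys : Δ * length keys ≤ N * (2 * D * ((2 * D + 2) * (n * n)))
    length-keys = begin
      Δ * length keys
        ≡⟨ cong (Δ *_) (length-concatMap-∑ (allFin N) at) ⟩
      Δ * (∑[ i ∈ allFin N ] length (at i))
        ≤⟨ *-monoʳ-≤ Δ (∑-≤-const (allFin N) λ {i} _ → at≤ i) ⟩
      Δ * (length (allFin N) * (2 * D * (∑[ v ∈ V ] length (opposite v))))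
        ≡⟨ cong (λ a → Δ * (a * (2 * D * (∑[ v ∈ V ] length (opposite v))))) (length-allFin N) ⟩
      Δ * (N * (2 * D * (∑[ v ∈ V ] length (opposite v))))
        ≡⟨ lem Δ N (2 * D) _ ⟩
      N * (2 * D * (Δ * (∑[ v ∈ V ] length (opposite v))))
        ≤⟨ *-monoʳ-≤ N (*-monoʳ-≤ (2 * D) ∑-opposite) ⟩
      N * (2 * D * ((2 * D + 2) * (n * n))) ∎
      where
      open ≤-Reasoning
      lem : ∀ a b c d → a * (b * (c * d)) ≡ b * (c * (a * d))
      lem = solve-∀
      lem' : ∀ d a → d * (a + a) ≡ 2 * d * a
      lem' = solve-∀
      at : Fin N → List Key
      at i = concatMap (λ v → concatMap (λ x →
        map (λ y → i , v , x , y) (filter (adj? G x) (opposite v))) (opposite v)) V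
      at≤ : ∀ i → length (at i) ≤ 2 * D * (∑[ v ∈ V ] length (opposite v))
      at≤ i = begin
        length (at i)
          ≡⟨ length-concatMap-∑ V _ ⟩
        ∑[ v ∈ V ] length (concatMap (λ x → map (λ y → i , v , x , y) (filter (adj? G x) (opposite v))) (opposite v))
          ≤⟨ ∑-mono V (λ {v} _ → at-v v) ⟩
        ∑[ v ∈ V ] 2 * D * length (opposite v)
          ≡⟨ ∑-*ˡ V (2 * D) ⟩
        2 * D * (∑[ v ∈ V ] length (opposite v)) ∎
        where
        at-v : ∀ v → length (concatMap (λ x → map (λ y → i , v , x , y) (filter (adj? G x) (opposite v))) (opposite v)) ≤ 2 * D * length (opposite v)
        at-v v = begin
          length (concatMap (λ x → map (λ y → i , v , x , y) (filter (adj? G x) (opposite v))) (opposite v))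
            ≡⟨ length-concatMap-∑ (opposite v) _ ⟩
          ∑[ x ∈ opposite v ] length (map (λ y → i , v , x , y) (filter (adj? G x) (opposite v)))
            ≤⟨ ∑-mono (opposite v) (λ {x} _ → ≤-reflexive (trans (length-map _ (filter (adj? G x) (opposite v))) (length-filter-∑ (adj? G x) (opposite v)))) ⟩
          ∑[ x ∈ opposite v ] ∑[ y ∈ opposite v ] 𝟙 (adj? G x y)
            ≤⟨ edges-between (opposite v) (opposite v) (filter⁺ (opposite? v) (allFin⁺ n)) (filter⁺ (opposite? v) (allFin⁺ n)) on (reaches-remote ∘ on) ⟩
          D * (length (opposite v) + length (opposite v))
            ≡⟨ lem' D _ ⟩
          2 * D * length (opposite v) ∎
          where
          on : ∀ {x} → x ∈ opposite v → Reaches G l x v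
          on x∈ = proj₁ (proj₂ (∈-filter⁻ (opposite? v) {xs = V} x∈))

    ∈-keys : ∀ {i v x y} → x ∈ opposite v → y ∈ opposite v → Adj G x y → (i , v , x , y) ∈ keys
    ∈-keys {i} {v} {x} {y} x∈ y∈ a =
      ∈-concatMap⁺ _ (lose (∈-allFin i) (∈-concatMap⁺ _ (lose (∈-allFin v) (∈-concatMap⁺ _ (lose x∈ (∈-map⁺ _ (∈-filter⁺ (adj? G x) y∈ a)))))))

    module Segments (c : Cycle G N) (i : ℕ) where
      open Cycle c

      -- The two arcs from the ends of the opposite edge to the root at time `i`: one runs back from
      -- i + l, the other forward from i + l + 1 to i + N.
      fall rise : ℕ → Fin n
      fall t = ψ (i + l ∸ t)
      rise t   = ψ (i + suc l + t)

      3≤N : 3 ≤ N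
      3≤N = s≤s (*-monoʳ-≤ 2 1≤l)

      ψ-NB : ∀ r → ψ r ≢ ψ (2 + r)
      ψ-NB r = distinct (m≤n⇒m≤1+n ≤-refl) (≤-trans (≤-reflexive (+-comm 3 r)) (+-monoʳ-≤ r 3≤N))

      down-step : ∀ {t} → t < l → i + l ∸ t ≡ suc (i + l ∸ suc t)
      down-step t<l = ∸-step (≤-trans t<l (m≤n+m l i))

      downs ups : List (Fin n)
      downs = applyUpTo (fall ∘ suc) l
      ups   = applyUpTo (rise ∘ suc) l

      NB-down : NB G (fall 0 ∷ downs)
      NB-down = NB-applyUpTo G l fall
        (λ {t} t<l → subst (λ r → Adj G (ψ r) (fall (suc t))) (sym (down-step t<l)) (Adj-sym G (adjacent-suc _)))
        (λ {t} t<l e → ψ-NB (i + l ∸ (2 + t)) (trans (sym e) (cong ψ (trans (down-step (<⇒≤ t<l)) (cong suc (down-step t<l))))))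

      NB-up : NB G (rise 0 ∷ ups)
      NB-up = NB-applyUpTo G l rise
        (λ {t} _ → subst (λ r → Adj G (rise t) (ψ r)) (sym (+-suc (i + suc l) t)) (adjacent-suc _))
        (λ {t} _ e → ψ-NB (i + suc l + t) (trans e (cong ψ (trans (+-suc _ (suc t)) (cong suc (+-suc _ t))))))

      end-down : end (fall 0) downs ≡ ψ i
      end-down = trans (end-applyUpTo fall l) (cong ψ (m+n∸n≡m i l))

      up-l : i + suc l + l ≡ i + N
      up-l = trans (+-assoc i (suc l) l) (cong (λ a → i + suc a) l+l≡2l)

      end-up : end (rise 0) ups ≡ ψ i
      end-up = trans (end-applyUpTo rise l) (trans (cong ψ up-l) (periodic i))

      x y : Fin n
      x = ψ (i + l)
      y = rise 0

      reaches-x : Reaches G l x (ψ i)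
      reaches-x = downs , length-applyUpTo (fall ∘ suc) l , NB-down , end-down

      reaches-y : Reaches G l y (ψ i)
      reaches-y = ups , length-applyUpTo (rise ∘ suc) l , NB-up , end-up

      adj-xy : Adj G x y
      adj-xy = subst (λ r → Adj G x (ψ r)) (sym (trans (+-identityʳ _) (+-suc i l))) (adjacent-suc (i + l))

      module _ (ok : Δ < deg G (ψ i) ⊎ (∀ t → deg G (ψ t) ≤ Δ)) where

        x∈opposite : x ∈ opposite (ψ i)
        x∈opposite = ∈-filter⁺ (opposite? (ψ i)) (∈-allFin x) (reaches-x , (case ok of λ where
          (inj₁ h) → inj₁ h
          (inj₂ low) → inj₂ (subst (λ r → Pow _⇝?_ l (ψ r) x) (+-identityʳ i)
            (Pow-walk _⇝?_ l (λ t → ψ (i + t)) λ {t} _ → low _ ,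
              subst (λ r → Adj G (ψ (i + t)) (ψ r)) (sym (+-suc i t)) (adjacent-suc _)))))

        y∈opposite : y ∈ opposite (ψ i)
        y∈opposite = ∈-filter⁺ (opposite? (ψ i)) (∈-allFin y) (reaches-y , (case ok of λ where
          (inj₁ h) → inj₁ h
          -- From the root to `y` the cycle is followed backwards, from time i + N to time i + l +
          -- 1.
          (inj₂ low) → inj₂ (subst₂ (Pow _⇝?_ l) (trans (cong ψ up-l) (periodic i)) (cong ψ (trans (m+n∸n≡m (i + suc l) l) (sym (+-identityʳ _))))
            (Pow-walk _⇝?_ l (λ t → ψ (i + suc l + l ∸ t)) λ {t} t<l → low _ ,
              subst (λ r → Adj G (ψ r) (ψ (i + suc l + l ∸ suc t))) (sym (∸-step (≤-trans t<l (m≤n+m l (i + suc l)))))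
                (Adj-sym G (adjacent-suc _))))))

    -- By the girth, the two arcs from the root to the ends of the opposite edge are determined by their ends.
    segments-determine : ∀ (c c' : Cycle G N) {i} → i < N →
      Cycle.ψ c i ≡ Cycle.ψ c' i → Segments.x c i ≡ Segments.x c' i → Segments.y c i ≡ Segments.y c' i →
      ∀ {j} → j < N → Cycle.ψ c j ≡ Cycle.ψ c' j
    segments-determine c c' {i} i<N v≡ x≡ y≡ {j} j<N = case i ≤? j of λ where
        (yes i≤j) → subst₂ _≡_ (cong ψ (m+[n∸m]≡n i≤j)) (cong ψ' (m+[n∸m]≡n i≤j)) (from-i (≤-<-trans (m∸n≤m j i) j<N))
        -- An index below `i` is raised by one period, into the range that `from-i` covers.
        (no i≰j) → let d = i + (j + N ∸ i)
                       e : d ≡ j + N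
                       e = m+[n∸m]≡n (≤-trans (<⇒≤ i<N) (m≤n+m N j))
                   in trans (sym (Cycle.periodic c j)) (trans (subst₂ _≡_ (cong ψ e) (cong ψ' e)
                        (from-i (+-cancelˡ-< i _ _ (subst (_< i + N) (sym e) (+-monoˡ-< N (≰⇒> i≰j))))))
                        (Cycle.periodic c' j))
      where
      open Cycle c using (ψ)
      open Cycle c' using () renaming (ψ to ψ')
      module S = Segments c i
      module S' = Segments c' i
      downs≡ : S.downs ≡ S'.downs
      downs≡ = NB-path-unique S.NB-down (subst (λ z → NB G (z ∷ S'.downs)) (sym x≡) S'.NB-down)
        (trans S.end-down (trans v≡ (trans (sym S'.end-down) (cong (λ z → end z S'.downs) (sym x≡)))))
        (≤-reflexive (trans (cong₂ _+_ (length-applyUpTo (S.fall ∘ suc) l) (length-applyUpTo (S'.fall ∘ suc) l)) l+l≡2l))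
      ups≡ : S.ups ≡ S'.ups
      ups≡ = NB-path-unique S.NB-up (subst (λ z → NB G (z ∷ S'.ups)) (sym y≡) S'.NB-up)
        (trans S.end-up (trans v≡ (trans (sym S'.end-up) (cong (λ z → end z S'.ups) (sym y≡)))))
        (≤-reflexive (trans (cong₂ _+_ (length-applyUpTo (S.rise ∘ suc) l) (length-applyUpTo (S'.rise ∘ suc) l)) l+l≡2l))
      down≡ : ∀ {t} → t ≤ l → S.fall t ≡ S'.fall t
      down≡ {zero}  _ = x≡
      down≡ {suc t} p = applyUpTo-≡ l downs≡ p
      up≡ : ∀ {t} → t ≤ l → S.rise t ≡ S'.rise t
      up≡ {zero}  _ = y≡
      up≡ {suc t} p = applyUpTo-≡ l ups≡ p
      from-i : ∀ {d} → d < N → ψ (i + d) ≡ ψ' (i + d)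
      from-i {d} d<N with d ≤? l
      -- The first l + 1 positions after the root lie on the falling arc, read in reverse; the
      -- others lie on the rising arc.
      ... | yes d≤l = subst₂ _≡_ (cong ψ e) (cong ψ' e) (down≡ (m∸n≤m l d))
        where
        e : i + l ∸ (l ∸ d) ≡ i + d
        e = trans (+-∸-assoc i (m∸n≤m l d)) (cong (i +_) (m∸[m∸n]≡n d≤l))
      ... | no d≰l = subst₂ _≡_ (cong ψ e) (cong ψ' e) (up≡ t≤l)
        where
        e : i + suc l + (d ∸ suc l) ≡ i + d
        e = trans (+-assoc i (suc l) _) (cong (i +_) (m+[n∸m]≡n (≰⇒> d≰l)))
        t≤l : d ∸ suc l ≤ l
        t≤l = ≤-trans (∸-monoˡ-≤ (suc l) (s≤s⁻¹ d<N)) (≤-trans (∸-monoʳ-≤ (2 * l) (n≤1+n l)) (≤-reflexive (trans (cong (_∸ l) (sym l+l≡2l)) (m+n∸n≡m l l))))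

    cycleOf : ∀ {S} → IsCopy (C N) G S → Cycle G N
    cycleOf {S} copy = copy⇒Cycle {G = G} (s≤s (≤-trans 1≤l (m≤m+n l _))) (S , copy)

    -- A relation, since the unrolled cycle depends on the isomorphism contained in the proof of
    -- `IsCopy`.
    HasKey : Subgraph n → Key → Set
    HasKey S (i , v , x , y) = ∃ λ (copy : IsCopy (C N) G S) →
      let c = cycleOf {S} copy in
      Cycle.ψ c (toℕ i) ≡ v × Segments.x c (toℕ i) ≡ x × Segments.y c (toℕ i) ≡ y

    -- A common key makes the two tables of values agree at every index, by `segments-determine`,
    -- and a copy is determined by its table.
    HasKey-injective : ∀ {S S' κ} → HasKey S κ → HasKey S' κ → S ≡ S'
    HasKey-injective {S} {S'} {i , _} (copy@(sub , φ , iso) , v≡ , x≡ , y≡) (copy'@(sub' , φ' , iso') , v≡' , x≡' , y≡') =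
      copy-determined {H = C N} {G = G} S S' {φ} {φ'} sub sub' iso iso' λ j →
        subst (λ j → Vec.lookup φ j ≡ Vec.lookup φ' j) (toℕ-injective (trans (toℕ-mod (toℕ j)) (m<n⇒m%n≡m (toℕ<n j))))
          (segments-determine (cycleOf {S} copy) (cycleOf {S'} copy') (toℕ<n i)
            (trans v≡ (sym v≡')) (trans x≡ (sym x≡')) (trans y≡ (sym y≡')) (toℕ<n j))

    hasKey : ∀ {S} → IsCopy (C N) G S → ∃ λ κ → κ ∈ keys × HasKey S κ
    hasKey {S} copy = case any? (λ (i : Fin N) → Δ <? deg G (ψ (toℕ i))) of λ where
        (yes (i , high)) → key i (inj₁ high)
        -- If all degrees are low, any vertex can be the root; position 0 is taken.
        (no ¬high) → key zero (inj₂ λ t → ≮⇒≥ λ high → ¬high (fromℕ< (m%n<n t N) ,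
          subst (λ u → Δ < deg G u) (trans (Cycle-% G c t) (cong ψ (sym (toℕ-fromℕ< (m%n<n t N))))) high))
      where
      c = cycleOf {S} copy
      open Cycle c using (ψ)
      key : ∀ i → (Δ < deg G (ψ (toℕ i)) ⊎ (∀ t → deg G (ψ t) ≤ Δ)) → ∃ λ κ → κ ∈ keys × HasKey S κ
      key i ok = (i , ψ (toℕ i) , x , y) , ∈-keys (x∈opposite ok) (y∈opposite ok) adj-xy , copy , refl , refl , refl
        where open Segments c (toℕ i)

    copies-bound : Δ * copies (C N) G ≤ N * (2 * D * ((2 * D + 2) * (n * n)))
    copies-bound = ≤-trans (*-monoʳ-≤ Δ (pigeonhole HasKey (λ {S} {S'} {κ} → HasKey-injective {S} {S'} {κ})
      (filter⁺ (isCopy? (C N) G) (Unique-subgraphs n))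
      (λ {S} S∈ → hasKey {S} (proj₂ (∈-filter⁻ (isCopy? (C N) G) {xs = subgraphs n} S∈))))) length-keys

-- The lower bound

-- A cycle inside the cycle C N runs through all of it, since a successor of each of its vertices is one of its two neighbours.
module _ {N M' : ℕ} (2≤N : 2 ≤ N) (3≤M : 3 ≤ suc M') (c : Cycle (C N) (suc M')) where

  open Cycle c renaming (ψ to ι)

  private
    M : ℕ
    M = suc M'

  -- The neighbours of `ι t` on the cycle are distinct because its length is at least 3, so they
  -- cannot both be the predecessor of `ι t` in `C N`. Time t + M' stands for t - 1.
  successor-hit : ∀ t → ∃ λ t' → ι t ↝ ι t'
  successor-hit t
    with Adj-C⁻ {i = ι (t + M')} (adjacent-suc (t + M')) | Adj-C⁻ {i = ι (suc (t + M'))} (adjacent-suc (suc (t + M')))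
  ... | _      | inj₁ p = suc (suc (t + M')) , subst (λ u → u ↝ ι (suc (suc (t + M')))) (trans (cong ι (sym (+-suc t M'))) (periodic t)) p
  ... | inj₂ p | _      = t + M' , subst (λ u → u ↝ ι (t + M')) (trans (cong ι (sym (+-suc t M'))) (periodic t)) p
  ... | inj₁ p | inj₂ q = contradiction (↝-injective p q)
        (distinct (m≤n⇒m≤1+n ≤-refl) (≤-trans (≤-reflexive (+-comm 3 (t + M'))) (+-monoʳ-≤ (t + M') 3≤M)))

  -- Successors are followed upwards; `a` counts the steps left before the wrap to 0.
  zero-hit : ∀ a t → toℕ (ι t) + suc a ≡ N → ∃ λ t' → toℕ (ι t') ≡ 0
  zero-hit a t e with successor-hit t
  zero-hit a t e       | t' , inj₂ (_ , z) = t' , z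
  zero-hit zero t e    | t' , inj₁ p = contradiction (trans (sym p) (trans (sym (+-comm _ 1)) e)) (<⇒≢ (toℕ<n (ι t')))
  zero-hit (suc a) t e | t' , inj₁ p = zero-hit a t' (trans (cong (_+ suc a) (sym p)) (trans (sym (+-suc _ (suc a))) e))

  all-hit : ∀ {a} → a < N → ∃ λ t → toℕ (ι t) ≡ a
  all-hit {zero}  _ = zero-hit (N ∸ suc (toℕ (ι 0))) 0
    (trans (+-suc _ _) (m+[n∸m]≡n (toℕ<n (ι 0))))
  all-hit {suc a} a<N with t , e ← all-hit (<⇒≤ a<N) with successor-hit t
  ... | t' , inj₁ p       = t' , trans (sym p) (cong suc e)
  ... | _  , inj₂ (p , _) = contradiction (trans (cong suc (sym e)) p) (<⇒≢ a<N)

  cycle-in-C : M ≡ N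
  cycle-in-C = ≤-antisym (injective⇒≤ {f = λ t → ι (toℕ t)} ι-inj) (injective⇒≤ {f = time} time-inj)
    where
    ι-inj : ∀ {s t : Fin M} → ι (toℕ s) ≡ ι (toℕ t) → s ≡ t
    ι-inj {s} {t} e with <-cmp (toℕ s) (toℕ t)
    ... | tri< l _ _ = contradiction e (distinct l (≤-trans (toℕ<n t) (m≤n+m M _)))
    ... | tri≈ _ q _ = toℕ-injective q
    ... | tri> _ _ g = contradiction (sym e) (distinct g (≤-trans (toℕ<n s) (m≤n+m M _)))
    time : Fin N → Fin M
    time j = proj₁ (all-hit (toℕ<n j)) mod M
    time-hits : ∀ j → ι (toℕ (time j)) ≡ j
    time-hits j = let t , e = all-hit (toℕ<n j) in
      trans (cong ι (toℕ-mod t)) (trans (sym (Cycle-% (C N) c t)) (toℕ-injective e))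
    time-inj : ∀ {i j} → time i ≡ time j → i ≡ j
    time-inj {i} {j} e = trans (sym (time-hits i)) (trans (cong (ι ∘ toℕ) e) (time-hits j))

-- Bounded distance and scattered vertices

module _ (G : Graph n) where

  _≈_ : Fin n → Fin n → Set
  u ≈ v = u ≡ v ⊎ Adj G u v

  _≈?_ : ∀ u v → Dec (u ≈ v)
  u ≈? v = (u ≟ᶠ v) ⊎-dec adj? G u v

  -- Steps may be idle, so this is distance at most s.
  Within : ℕ → Fin n → Fin n → Set
  Within = Pow _≈?_

  within-refl : ∀ s {u} → Within s u u
  within-refl zero    = refl
  within-refl (suc s) = _ , within-refl s , inj₁ refl

  within-mono : ∀ {s t u v} → s ≤ t → Within s u v → Within t u v
  within-mono {t = t} z≤n     refl        = within-refl t
  within-mono         (s≤s p) (w , q , a) = w , within-mono p q , a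

  within-∷ : ∀ s {u w v} → u ≈ w → Within s w v → Within (suc s) u v
  within-∷ zero    a refl        = _ , refl , a
  within-∷ (suc s) a (x , p , b) = x , within-∷ s a p , b

  within-sym : ∀ s {u v} → Within s u v → Within s v u
  within-sym zero    refl        = refl
  within-sym (suc s) (w , p , a) = within-∷ s (≈-sym a) (within-sym s p)
    where
    ≈-sym : ∀ {u v} → u ≈ v → v ≈ u
    ≈-sym (inj₁ e) = inj₁ (sym e)
    ≈-sym (inj₂ a) = inj₂ (Adj-sym G a)

  within-count : ∀ {Δ} → (∀ v → deg G v ≤ Δ) → ∀ s v → ∑[ x ∈ allFin n ] 𝟙 (pow? _≈?_ s v x) ≤ suc Δ ^ s
  within-count {Δ} maxdeg = pow-count _≈?_ λ w → begin
    ∑[ x ∈ allFin n ] 𝟙 (w ≈? x)                                ≤⟨ ∑-mono (allFin n) (λ {x} _ → split w x) ⟩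
    ∑[ x ∈ allFin n ] (𝟙 (w ≟ᶠ x) + 𝟙 (adj? G w x))             ≡⟨ ∑-distrib-+ (allFin n) ⟩
    (∑[ x ∈ allFin n ] 𝟙 (w ≟ᶠ x)) + deg G w                    ≤⟨ +-mono-≤ (∑-≟≤1 w) (maxdeg w) ⟩
    suc Δ ∎
    where
    open ≤-Reasoning
    split : ∀ w x → 𝟙 (w ≈? x) ≤ 𝟙 (w ≟ᶠ x) + 𝟙 (adj? G w x)
    split w x with w ≟ᶠ x | adj? G w x
    ... | yes _ | _     = s≤s z≤n
    ... | no _  | yes _ = ≤-refl
    ... | no _  | no _  = z≤n

  module _ {P : Fin n → Set} (P? : ∀ v → Dec (P v)) {b} (r : ℕ)
           (ball : ∀ v → ∑[ x ∈ allFin n ] 𝟙 (pow? _≈?_ r v x) ≤ b) where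

    -- Greedy choice: each chosen vertex excludes its ball of at most `b` vertices, so i + 1 choices
    -- succeed while (i + 1) b is below the number of candidates.
    scattered : ∀ i → i * b < length (filter P? (allFin n)) → ∃ λ (φ : Vec (Fin n) i) →
      (∀ j → P (Vec.lookup φ j)) × (∀ j j' → j ≢ j' → ¬ Within r (Vec.lookup φ j) (Vec.lookup φ j'))
    scattered zero    lt = [] , (λ ()) , λ ()
    scattered (suc i) lt =
      let φ , low , far = scattered i (≤-<-trans (m≤n+m _ b) lt)
          balls = concatMap (λ j → filter (pow? _≈?_ r (Vec.lookup φ j)) (allFin n)) (allFin i)
          small : length balls ≤ i * b
          small = ≤-trans (≤-reflexive (length-concatMap-∑ (allFin i) _))
            (≤-trans (∑-≤-const (allFin i) λ {j} _ → ≤-trans (≤-reflexive (length-filter-∑ (pow? _≈?_ r (Vec.lookup φ j)) (allFin n))) (ball _))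
                     (≤-reflexive (cong (_* b) (length-allFin i))))
          v , _ , pv , v∉ = filter-escape P? _≟ᶠ_ balls (allFin⁺ n)
            (subst (length balls <_) (length-filter-∑ P? (allFin n)) (≤-<-trans small (≤-<-trans (m≤n+m _ b) lt)))
          away : ∀ j → ¬ Within r (Vec.lookup φ j) v
          away j w = v∉ (∈-concatMap⁺ _ (lose (∈-allFin j) (∈-filter⁺ (pow? _≈?_ r (Vec.lookup φ j)) (∈-allFin v) w)))
      in v ∷ φ , (λ { zero → pv ; (suc j) → low j }) , λ where
           zero    zero     ne → contradiction refl ne
           zero    (suc j') ne → away j' ∘ within-sym r
           (suc j) zero     ne → away j
           (suc j) (suc j') ne → far j j' (ne ∘ cong suc)

-- Adding one cycle on scattered vertices

module AddCycle {n : ℕ} (G : Graph n) (N r : ℕ) (2≤N : 2 ≤ N) (1≤r : 1 ≤ r) (φ : Vec (Fin n) N)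
  (far : ∀ j j' → j ≢ j' → ¬ Within G r (Vec.lookup φ j) (Vec.lookup φ j')) where

  φ-inj : Injective _≡_ _≡_ (Vec.lookup φ)
  φ-inj {i} {j} e with i ≟ᶠ j
  ... | yes i≡j = i≡j
  ... | no i≢j  = contradiction (subst (Within G r _) e (within-refl G r)) (far i j i≢j)

  New : Fin n → Fin n → Set
  New = ImageAdj (C N) φ

  new? : ∀ u v → Dec (New u v)
  new? = imageAdj? (C N) φ

  private
    step? : ∀ u v → Dec (Adj G u v ⊎ New u v)
    step? u v = adj? G u v ⊎-dec new? u v

    step-sym : ∀ {u v} → Adj G u v ⊎ New u v → Adj G v u ⊎ New v u
    step-sym (inj₁ a) = inj₁ (Adj-sym G a)
    step-sym (inj₂ b) = inj₂ (ImageAdj-sym (C N) φ b)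

  G⁺ : Graph n
  G⁺ = fromRel step?

  G⁺⁻ : ∀ {u v} → Adj G⁺ u v → Adj G u v ⊎ New u v
  G⁺⁻ = fromRel⁻ step? (λ {u} {v} → step-sym {u} {v})

  G⁺⁺ : ∀ {u v} → Adj G u v ⊎ New u v → Adj G⁺ u v
  G⁺⁺ = fromRel⁺ step? (λ {u} {v} → step-sym {u} {v}) λ where
    (inj₁ a) → Adj-irrefl G a
    (inj₂ b) → ImageAdj-irrefl (C N) φ φ-inj b

  On : Fin n → Set
  On v = ∃ λ i → Vec.lookup φ i ≡ v

  New⇒On : ∀ {u v} → New u v → On u × On v
  New⇒On (i , j , p , q , _) = (i , p) , (j , q)

  on-far : ∀ {s u v} → On u → On v → u ≢ v → s ≤ r → ¬ Within G s u v
  on-far (i , refl) (j , refl) u≢v s≤r w = far i j (u≢v ∘ cong (Vec.lookup φ)) (within-mono G s≤r w)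

  -- The old edges of a short cycle with a new edge would form walks between vertices of the new cycle.
  module Short {M : ℕ} (c : Cycle G⁺ M) (M≤ : M ≤ suc r) (start : New (Cycle.ψ c 0) (Cycle.ψ c 1)) where
    open Cycle c

    -- An old walk that has left the new cycle at `ψ s` is followed for the remaining `f` steps. It
    -- cannot take a new edge before it meets the new cycle again, and it must do so by `ψ 0`; then
    -- two vertices of the new cycle are within distance `r`.
    no-return : ∀ f d {s} → 1 ≤ s → 1 ≤ d → On (ψ s) → Within G d (ψ s) (ψ (d + s)) → f + (d + s) ≡ M → ⊥
    no-return f d {s} 1≤s 1≤d on w e with ∈image? (C N) φ (ψ (d + s))
    ... | yes on' = on-far on on' (distinct (≤-trans (s≤s ≤-refl) (+-monoˡ-≤ s 1≤d)) (≤-<-trans d+s≤M (+-monoˡ-≤ M 1≤s)))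
                      (s≤s⁻¹ (≤-trans (≤-reflexive (+-comm 1 d)) (≤-trans (+-monoʳ-≤ d 1≤s) (≤-trans d+s≤M M≤)))) w
      where
      d+s≤M : d + s ≤ M
      d+s≤M = ≤-trans (m≤n+m _ f) (≤-reflexive e)
    no-return zero    d {s} 1≤s 1≤d on w e | no ¬on = ¬on (subst On (trans (sym (periodic 0)) (cong ψ (sym e))) (proj₁ (New⇒On start)))
    no-return (suc f) d {s} 1≤s 1≤d on w e | no ¬on with G⁺⁻ (adjacent-suc (d + s))
    ... | inj₁ a = no-return f (suc d) 1≤s (s≤s z≤n) on (ψ (d + s) , w , inj₂ a) (trans (+-suc f (d + s)) e)
    ... | inj₂ b = ¬on (proj₁ (New⇒On b))

    all-new : ∀ {s} → s < M → New (ψ s) (ψ (suc s))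
    all-new {zero}  _ = start
    all-new {suc s} s<M with G⁺⁻ (adjacent-suc (suc s))
    ... | inj₂ b = b
    ... | inj₁ a = ⊥-elim (no-return (M ∸ (2 + s)) 1 (s≤s z≤n) ≤-refl on (ψ (suc s) , refl , inj₂ a) (m∸n+n≡m s<M))
      where on = proj₂ (New⇒On (all-new (<⇒≤ s<M)))

  -- If some edge is not old, the cycle is shifted to start there and all its edges are new. Pulled
  -- back along the injective `φ`, it becomes a cycle in `C N`, so `cycle-in-C` gives its length.
  cycle-G⁺ : ∀ {M} → 3 ≤ M → M ≤ suc r → Cycle G⁺ M → Cycle G M ⊎ M ≡ N
  cycle-G⁺ {M@(suc M')} 3≤M M≤ c with anyUpTo? (λ t → ¬? (adj? G (Cycle.ψ c t) (Cycle.ψ c (suc t)))) M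
  ... | no ¬new = inj₁ record
        { ψ = ψ ; periodic = periodic ; distinct = distinct
        ; adjacent-suc = λ t → subst₂ (Adj G) (sym (Cycle-% G⁺ c t)) (sym (Cycle-suc% t))
            (decidable-stable (adj? G _ _) λ ¬a → ¬new (t % M , m%n<n t M , ¬a)) }
    where
    open Cycle c
    Cycle-suc% : ∀ t → ψ (suc t) ≡ ψ (suc (t % M))
    Cycle-suc% t = trans (cong (ψ ∘ suc) (m≡m%n+[m/n]*n t M)) (Cycle-mod G⁺ c (suc (t % M)) (t / M))
  ... | yes (t₀ , _ , ¬a) = inj₂ (cycle-in-C 2≤N 3≤M record
        { ψ = ι
        ; periodic = λ t → φ-inj (trans (φι (t + M)) (trans (periodic t) (sym (φι t))))
        ; adjacent-suc = λ t → let _ , j , _ , q , a = new t in subst (Adj (C N) (ι t)) (φ-inj (trans q (sym (φι (suc t))))) a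
        ; distinct = λ {s} {t} s<t t<s+M e → distinct s<t t<s+M (trans (sym (φι s)) (trans (cong (Vec.lookup φ) e) (φι t))) })
    where
    c' = Cycle.shift c t₀
    open Cycle c'
    start : New (ψ 0) (ψ 1)
    start with G⁺⁻ (adjacent-suc 0)
    ... | inj₂ b = b
    ... | inj₁ a = contradiction (subst₂ (λ x y → Adj G (Cycle.ψ c x) (Cycle.ψ c y)) (+-identityʳ t₀) (+-comm t₀ 1) a) ¬a
    new : ∀ t → New (ψ t) (ψ (suc t))
    new t = subst₂ New (sym (Cycle-% G⁺ c' t))
      (sym (trans (cong (ψ ∘ suc) (m≡m%n+[m/n]*n t M)) (Cycle-mod G⁺ c' (suc (t % M)) (t / M))))
      (Short.all-new c' M≤ start (m%n<n t M))
    ι : ℕ → Fin N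
    ι t = proj₁ (new t)
    φι : ∀ t → Vec.lookup φ (ι t) ≡ ψ t
    φι t = proj₁ (proj₂ (proj₂ (new t)))

  -- The indicator of `On`, written as a sum so that summation over the vertices can be exchanged
  -- with summation over the indices.
  indices : Fin n → ℕ
  indices v = ∑[ i ∈ allFin N ] 𝟙 (Vec.lookup φ i ≟ᶠ v)

  𝟙-new≤ : ∀ v u → 𝟙 (new? v u) ≤ ∑[ i ∈ allFin N ] ∑[ j ∈ allFin N ] 𝟙 (Vec.lookup φ i ≟ᶠ v) * (𝟙 (adj? (C N) i j) * 𝟙 (Vec.lookup φ j ≟ᶠ u))
  𝟙-new≤ v u with new? v u
  ... | no _ = z≤n
  ... | yes (i , j , p , q , a) = ≤-trans (≤-trans
        (≤-reflexive (sym (cong₂ _*_ (𝟙-true (Vec.lookup φ i ≟ᶠ v) p) (cong₂ _*_ (𝟙-true (adj? (C N) i j) a) (𝟙-true (Vec.lookup φ j ≟ᶠ u) q)))))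
        (∑-∈ (λ j → 𝟙 (Vec.lookup φ i ≟ᶠ v) * (𝟙 (adj? (C N) i j) * 𝟙 (Vec.lookup φ j ≟ᶠ u))) (∈-allFin j)))
        (∑-∈ (λ i → ∑[ j ∈ allFin N ] 𝟙 (Vec.lookup φ i ≟ᶠ v) * (𝟙 (adj? (C N) i j) * 𝟙 (Vec.lookup φ j ≟ᶠ u))) (∈-allFin i))

  new-degree : ∀ v → ∑[ u ∈ allFin n ] 𝟙 (new? v u) ≤ 2 * indices v
  new-degree v = begin
    ∑[ u ∈ V ] 𝟙 (new? v u)                                  ≤⟨ ∑-mono V (λ {u} _ → 𝟙-new≤ v u) ⟩
    ∑[ u ∈ V ] ∑[ i ∈ I ] ∑[ j ∈ I ] a i * (b i j * c j u)   ≡⟨ ∑-swap V I _ ⟩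
    ∑[ i ∈ I ] ∑[ u ∈ V ] ∑[ j ∈ I ] a i * (b i j * c j u)   ≤⟨ ∑-mono I (λ {i} _ → at i) ⟩
    ∑[ i ∈ I ] 2 * a i                                       ≡⟨ ∑-*ˡ I 2 ⟩
    2 * indices v ∎
    where
    open ≤-Reasoning
    V = allFin n
    I = allFin N
    a : Fin N → ℕ
    a i = 𝟙 (Vec.lookup φ i ≟ᶠ v)
    b : Fin N → Fin N → ℕ
    b i j = 𝟙 (adj? (C N) i j)
    c : Fin N → Fin n → ℕ
    c j u = 𝟙 (Vec.lookup φ j ≟ᶠ u)
    at : ∀ i → ∑[ u ∈ V ] ∑[ j ∈ I ] a i * (b i j * c j u) ≤ 2 * a i
    at i = begin
      ∑[ u ∈ V ] ∑[ j ∈ I ] a i * (b i j * c j u)   ≡⟨ ∑-swap V I _ ⟩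
      ∑[ j ∈ I ] ∑[ u ∈ V ] a i * (b i j * c j u)   ≤⟨ ∑-mono I (λ {j} _ → ≤-trans (≤-reflexive (trans (∑-*ˡ V (a i)) (cong (a i *_) (∑-*ˡ V (b i j)))))
                                                        (*-monoʳ-≤ (a i) (≤-trans (*-monoʳ-≤ (b i j) (∑-≟≤1 (Vec.lookup φ j))) (≤-reflexive (*-identityʳ _))))) ⟩
      ∑[ j ∈ I ] a i * b i j                        ≡⟨ ∑-*ˡ I (a i) ⟩
      a i * deg (C N) i                             ≤⟨ *-monoʳ-≤ (a i) (deg-C≤2 i) ⟩
      a i * 2                                       ≡⟨ *-comm (a i) 2 ⟩
      2 * a i ∎

  deg-G⁺ : ∀ v → deg G⁺ v ≤ deg G v + 2 * indices v
  deg-G⁺ v = ≤-trans (∑-mono (allFin n) λ {u} _ → split u)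
    (≤-trans (≤-reflexive (∑-distrib-+ (allFin n))) (+-monoʳ-≤ (deg G v) (new-degree v)))
    where
    split : ∀ u → 𝟙 (adj? G⁺ v u) ≤ 𝟙 (adj? G v u) + 𝟙 (new? v u)
    split u = case adj? G⁺ v u of λ where
        (no ¬a) → ≤-trans (≤-trans (𝟙-mono (adj? G⁺ v u) (no id) ¬a) z≤n) z≤n
        (yes a) → case G⁺⁻ a of λ where
          (inj₁ b) → ≤-trans (𝟙-mono (adj? G⁺ v u) (adj? G v u) (λ _ → b)) (m≤m+n _ _)
          (inj₂ b) → ≤-trans (𝟙-mono (adj? G⁺ v u) (new? v u) (λ _ → b)) (m≤n+m _ _)

  indices≤1 : ∀ v → indices v ≤ 1
  indices≤1 v = case ∈image? (C N) φ v of λ where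
      (yes (i , e)) → ≤-trans count (Unique-⊆⇒length≤ {ys = i ∷ []} u λ z∈ → here (φ-inj (trans (found z∈) (sym e))))
      (no ¬on)      → ≤-trans count (≤-trans (Unique-⊆⇒length≤ {ys = []} u λ z∈ → ⊥-elim (¬on (_ , found z∈))) z≤n)
    where
    is? : ∀ i → Dec (Vec.lookup φ i ≡ v)
    is? i = Vec.lookup φ i ≟ᶠ v
    count = ≤-reflexive (sym (length-filter-∑ is? (allFin N)))
    u = filter⁺ is? (allFin⁺ N)
    found : ∀ {z} → z ∈ filter is? (allFin N) → Vec.lookup φ z ≡ v
    found z∈ = proj₂ (∈-filter⁻ is? {xs = allFin N} z∈)

  indices-off : ∀ {v} → ¬ On v → indices v ≤ 0
  indices-off {v} ¬on = ≤-trans (≤-reflexive (sym (length-filter-∑ is? (allFin N))))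
    (Unique-⊆⇒length≤ {ys = []} (filter⁺ is? (allFin⁺ N)) λ z∈ → ⊥-elim (¬on (_ , proj₂ (∈-filter⁻ is? {xs = allFin N} z∈))))
    where
    is? : ∀ i → Dec (Vec.lookup φ i ≡ v)
    is? i = Vec.lookup φ i ≟ᶠ v

  maxdeg-G⁺ : ∀ {Δ} → (∀ v → deg G v ≤ Δ) → (∀ j → deg G (Vec.lookup φ j) + 2 ≤ Δ) → ∀ v → deg G⁺ v ≤ Δ
  maxdeg-G⁺ {Δ} maxdeg low v = ≤-trans (deg-G⁺ v) (case ∈image? (C N) φ v of λ where
    (yes (j , refl)) → ≤-trans (+-monoʳ-≤ (deg G v) (*-monoʳ-≤ 2 (indices≤1 v))) (low j)
    (no ¬on) → ≤-trans (≤-trans (+-monoʳ-≤ (deg G v) (*-monoʳ-≤ 2 (indices-off ¬on))) (≤-reflexive (+-identityʳ _))) (maxdeg v))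

  total-G⁺ : ∑[ v ∈ allFin n ] deg G⁺ v ≤ (∑[ v ∈ allFin n ] deg G v) + 2 * N
  total-G⁺ = begin
    ∑[ v ∈ V ] deg G⁺ v                                     ≤⟨ ∑-mono V (λ {v} _ → deg-G⁺ v) ⟩
    ∑[ v ∈ V ] (deg G v + 2 * indices v)                    ≡⟨ ∑-distrib-+ V ⟩
    (∑[ v ∈ V ] deg G v) + (∑[ v ∈ V ] 2 * indices v)       ≡⟨ cong ((∑[ v ∈ V ] deg G v) +_) (trans (∑-*ˡ V 2) (cong (2 *_) (∑-swap V (allFin N) _))) ⟩
    (∑[ v ∈ V ] deg G v) + 2 * (∑[ i ∈ allFin N ] ∑[ v ∈ V ] 𝟙 (Vec.lookup φ i ≟ᶠ v))
      ≤⟨ +-monoʳ-≤ (∑[ v ∈ V ] deg G v) (*-monoʳ-≤ 2 (≤-trans (∑-≤-const (allFin N) λ {i} _ → ∑-≟≤1 (Vec.lookup φ i))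
           (≤-reflexive (trans (*-identityʳ _) (length-allFin N))))) ⟩
    (∑[ v ∈ V ] deg G v) + 2 * N ∎
    where
    open ≤-Reasoning
    V = allFin n

  -- Old copies survive. The added copy was not in `G`, since its edges join vertices that are at
  -- distance more than `r`, hence not adjacent, in `G`.
  copies-G⁺ : suc (copies (C N) G) ≤ copies (C N) G⁺
  copies-G⁺ = filter-subset-< (isCopy? (C N) G) (isCopy? (C N) G⁺)
    (λ (sub , iso) → (λ u v a → let b , w = sub u v a in G⁺⁺ (inj₁ b) , w) , iso)
    (∈-subgraphs (image (C N) φ))
    (image-isCopy (C N) φ φ-inj {G⁺} λ i j a → G⁺⁺ (inj₂ (i , j , refl , refl , a)))
    λ (sub , _) → let
        i = fromℕ< (≤-trans (n≤1+n 1) 2≤N)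
        j , i↝j = next i
        a = Adj-C⁺ {i = i} {j} 2≤N i↝j
        b = proj₁ (sub _ _ (fromRel⁺ new? (ImageAdj-sym (C N) φ) (ImageAdj-irrefl (C N) φ φ-inj) (i , j , refl , refl , a)))
      in on-far (i , refl) (j , refl) (Adj-≢ (C N) a ∘ φ-inj) 1≤r (_ , refl , inj₂ b)

-- The greedy construction

module Greedy (n k N δ : ℕ) (2≤N : 2 ≤ N) (2≤k : 2 ≤ k) (room : 2 * (N * (2 + δ) ^ pred (2 * k)) ≤ n) where

  private
    V = allFin n
    r = pred (2 * k)

    suc-r : suc r ≡ 2 * k
    suc-r = suc-pred (2 * k) {{>-nonZero (≤-trans (s≤s z≤n) (*-monoʳ-≤ 2 2≤k))}}

    1≤r : 1 ≤ r
    1≤r = s≤s⁻¹ (≤-trans (m≤n*m 2 2) (subst (2 * 2 ≤_) (sym suc-r) (*-monoʳ-≤ 2 2≤k)))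

  -- The state after `t` cycles have been added; each contributes at most 2N to the degree sum.
  record Stage (G : Graph n) (t : ℕ) : Set where
    field
      cycles : ∀ {M} → 3 ≤ M → M ≤ 2 * k → Cycle G M → M ≡ N
      maxdeg : ∀ v → deg G v ≤ suc δ
      total  : ∑[ v ∈ V ] deg G v ≤ 2 * N * t
      many   : t ≤ copies (C N) G

  low? : ∀ (G : Graph n) v → Dec (deg G v + 2 ≤ suc δ)
  low? G v = deg G v + 2 ≤? suc δ

  -- A vertex that is not low has degree at least δ, so nδ is at most δ times the number of low
  -- vertices plus the degree sum. Were the low vertices at most n/2, as `room` would give, a degree
  -- sum below nδ/2 would be too small.
  many-low : ∀ {G t} → Stage G t → 4 * N * t < n * δ → N * (2 + δ) ^ r < length (filter (low? G) V)
  many-low {G} {t} stage sparse = ≰⇒> λ few → <-irrefl refl (begin-strict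
    2 * (n * δ)                                         ≡⟨ cong (λ a → 2 * (a * δ)) (length-allFin n) ⟨
    2 * (length V * δ)                                  ≡⟨ cong (2 *_) (∑-const V δ) ⟨
    2 * (∑[ v ∈ V ] δ)                                  ≤⟨ *-monoʳ-≤ 2 (∑-mono V (λ {v} _ → split v)) ⟩
    2 * (∑[ v ∈ V ] (δ * 𝟙 (low? G v) + deg G v))       ≡⟨ cong (2 *_) (trans (∑-distrib-+ V) (cong (_+ (∑[ v ∈ V ] deg G v)) (trans (∑-*ˡ V δ) (cong (δ *_) (sym (length-filter-∑ (low? G) V)))))) ⟩
    2 * (δ * length (filter (low? G) V) + (∑[ v ∈ V ] deg G v))
      ≤⟨ *-monoʳ-≤ 2 (+-mono-≤ (*-monoʳ-≤ δ few) total) ⟩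
    2 * (δ * (N * (2 + δ) ^ r) + 2 * N * t)             ≡⟨ lem δ (N * (2 + δ) ^ r) N t ⟩
    δ * (2 * (N * (2 + δ) ^ r)) + 4 * N * t             <⟨ +-mono-≤-< (*-monoʳ-≤ δ room) sparse ⟩
    δ * n + n * δ                                       ≡⟨ lem' δ n ⟩
    2 * (n * δ) ∎)
    where
    open Stage stage
    open ≤-Reasoning
    lem : ∀ d x m t → 2 * (d * x + 2 * m * t) ≡ d * (2 * x) + 4 * m * t
    lem = solve-∀
    lem' : ∀ d m → d * m + m * d ≡ 2 * (m * d)
    lem' = solve-∀
    split : ∀ v → δ ≤ δ * 𝟙 (low? G v) + deg G v
    split v with low? G v
    ... | yes _ = ≤-trans (≤-reflexive (sym (*-identityʳ δ))) (m≤m+n _ _)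
    ... | no ¬low = ≤-trans (s≤s⁻¹ (s≤s⁻¹ (≤-trans (≰⇒> ¬low) (≤-reflexive (+-comm (deg G v) 2))))) (m≤n+m _ _)

  advance : ∀ {G t} → Stage G t → 4 * N * t < n * δ → ∃ λ G' → Stage G' (suc t)
  advance {G} {t} stage sparse =
    let φ , low , far = scattered G (low? G) r (within-count G maxdeg r) N (many-low stage sparse)
        open AddCycle G N r 2≤N 1≤r φ far
    in G⁺ , record
      { cycles = λ 3≤M M≤ c → case cycle-G⁺ 3≤M (≤-trans M≤ (≤-reflexive (sym suc-r))) c of λ where
          (inj₁ c') → cycles 3≤M M≤ c'
          (inj₂ e)  → e
      ; maxdeg = maxdeg-G⁺ maxdeg low
      ; total  = ≤-trans total-G⁺ (≤-trans (+-monoˡ-≤ (2 * N) total) (≤-reflexive (trans (+-comm _ (2 * N)) (sym (*-suc (2 * N) t)))))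
      ; many   = ≤-trans (s≤s many) copies-G⁺
      }
    where open Stage stage

  private
    edgeless : Graph n
    edgeless = fromRel {R = λ _ _ → ⊥} λ _ _ → no id

    no-edge : ∀ {u v} → ¬ Adj edgeless u v
    no-edge = fromRel⁻ {n = n} {R = λ _ _ → ⊥} (λ _ _ → no id) id

    deg-edgeless : ∀ v → deg edgeless v ≤ 0
    deg-edgeless v = ≤-trans (∑-≤-const V {c = 0} λ {u} _ → 𝟙-mono (adj? edgeless v u) (no id) no-edge) (≤-reflexive (*-zeroʳ (length V)))

  -- After `T` rounds, either every round has added a cycle or the target has been reached earlier.
  stages : ∀ T → ∃ λ G → ∃ λ t → Stage G t × (t ≡ T ⊎ n * δ ≤ 4 * N * t)
  stages zero    = edgeless , 0 , record
    { cycles = λ _ _ c → ⊥-elim (no-edge (Cycle.adjacent-suc c 0))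
    ; maxdeg = λ v → ≤-trans (deg-edgeless v) z≤n
    ; total  = ≤-trans (∑-≤-const V {c = 0} λ {v} _ → deg-edgeless v) (≤-trans (≤-reflexive (*-zeroʳ (length V))) z≤n)
    ; many   = z≤n } , inj₁ refl
  stages (suc T) with stages T
  ... | G , t , stage , inj₂ done = G , t , stage , inj₂ done
  ... | G , t , stage , inj₁ e with n * δ ≤? 4 * N * t
  ...   | yes done = G , t , stage , inj₂ done
  ...   | no ¬done = let G' , stage' = advance stage (≰⇒> ¬done) in G' , suc t , stage' , inj₁ (cong suc e)

  many-copies : ∃ λ (G : Graph n) → (∀ {M} → 3 ≤ M → M ≤ 2 * k → Cycle G M → M ≡ N) × n * δ ≤ 4 * N * copies (C N) G
  many-copies =
    -- With nδ rounds the first alternative also reaches the target, as then t = nδ.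
    let G , t , stage , bound = stages (n * δ)
        open Stage stage
    in G , cycles , ≤-trans (case bound of λ where
         (inj₁ e) → ≤-trans (≤-reflexive (sym e)) (m≤n*m t (4 * N) {{>-nonZero (*-mono-≤ {1} {4} {1} {N} (s≤s z≤n) (≤-trans (n≤1+n 1) 2≤N))}})
         (inj₂ le)   → le) (*-monoʳ-≤ (4 * N) many)

-- The theorem

family : ℕ → ℕ → Family
family k l = cycles3to (2 * l) ++ [ (2 * k , C (2 * k)) ]

Free⇒girth : ∀ {n k l} {G : Graph n} → Free (family k l) G → ∀ {m} → 3 ≤ m → m ≤ 2 * l → ¬ ∃ (IsCopy (C m) G)
Free⇒girth {l = l} free (s≤s (s≤s (s≤s _))) m≤2l = All.applyUpTo⁻ (λ i → 3 + i , C (3 + i)) (2 * l ∸ 2) (All.++⁻ˡ (cycles3to (2 * l)) free) (∸-monoˡ-≤ 2 m≤2l)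

Free⇒noC₂ₖ : ∀ {n k l} {G : Graph n} → Free (family k l) G → ¬ ∃ (IsCopy (C (2 * k)) G)
Free⇒noC₂ₖ {l = l} free with none ∷ [] ← All.++⁻ʳ (cycles3to (2 * l)) free = none

-- All forbidden lengths lie between 3 and 2k and differ from 2l + 1: they are at most 2l, or even.
cycles⇒Free : ∀ {n k l} {G : Graph n} → l < k → 2 ≤ l →
  (∀ {M} → 3 ≤ M → M ≤ 2 * k → Cycle G M → M ≡ suc (2 * l)) → Free (family k l) G
cycles⇒Free {k = k} {l} {G} l<k 2≤l only = All.++⁺
  (All.applyUpTo⁺₁ (λ i → 3 + i , C (3 + i)) (2 * l ∸ 2) λ {i} i< copy →
    let i≤ = ≤-trans (+-monoʳ-≤ 2 i<) (≤-reflexive (m+[n∸m]≡n (≤-trans 2≤l (m≤m+n l _)))) in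
    <⇒≢ (s≤s i≤) (only 3≤3+i (≤-trans i≤ (*-monoʳ-≤ 2 (<⇒≤ l<k))) (copy⇒Cycle {G = G} (<⇒≤ 3≤3+i) copy)))
  ((λ copy → even≢odd k l (only 3≤2k ≤-refl (copy⇒Cycle {G = G} (<⇒≤ 3≤2k) copy))) ∷ [])
  where
  3≤3+i : ∀ {i} → 3 ≤ 3 + i
  3≤3+i = s≤s (s≤s (s≤s z≤n))
  3≤2k : 3 ≤ 2 * k
  3≤2k = ≤-trans (n≤1+n 3) (*-monoʳ-≤ 2 (≤-trans 2≤l (<⇒≤ l<k)))

-- Exponents and constants

^-distribˡ-* : ∀ a b q → (a * b) ^ q ≡ a ^ q * b ^ q
^-distribˡ-* a b zero    = refl
^-distribˡ-* a b (suc q) = trans (cong (a * b *_) (^-distribˡ-* a b q)) (lem a b (a ^ q) (b ^ q))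
  where
  lem : ∀ a b c d → a * b * (c * d) ≡ a * c * (b * d)
  lem = solve-∀

-- With q = l + 1, multiplication by n ≤ (2Δ)^q turns c^q into (2Δc)^q ≤ (2K)^q n^(2q). Cancelling
-- one factor n leaves the exponent 2q - 1 = q + l.
upper-arithmetic : ∀ l n Δ c K → 1 ≤ n → 1 ≤ Δ → n < suc Δ ^ suc l → Δ * c ≤ K * (n * n) →
                   c ^ suc l ≤ (2 * K) ^ suc l * n ^ (suc l + l)
upper-arithmetic l n Δ c K 1≤n 1≤Δ n< Δc≤ = *-cancelˡ-≤ n {{>-nonZero 1≤n}} (begin
  n * c ^ q                               ≤⟨ *-monoˡ-≤ (c ^ q) (≤-trans (<⇒≤ n<) (^-monoˡ-≤ q (+-mono-≤ 1≤Δ (≤-reflexive (sym (+-identityʳ Δ)))))) ⟩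
  (2 * Δ) ^ q * c ^ q                     ≡⟨ ^-distribˡ-* (2 * Δ) c q ⟨
  (2 * Δ * c) ^ q                         ≤⟨ ^-monoˡ-≤ q (≤-trans (≤-reflexive (*-assoc 2 Δ c)) (≤-trans (*-monoʳ-≤ 2 Δc≤) (≤-reflexive (sym (*-assoc 2 K _))))) ⟩
  (2 * K * (n * n)) ^ q                   ≡⟨ ^-distribˡ-* (2 * K) (n * n) q ⟩
  (2 * K) ^ q * (n * n) ^ q               ≡⟨ cong ((2 * K) ^ q *_) (trans (^-distribˡ-* n n q) (sym (^-distribˡ-+-* n q q))) ⟩
  (2 * K) ^ q * n ^ (q + q)               ≡⟨ cong (λ e → (2 * K) ^ q * n ^ e) (+-suc q l) ⟩
  (2 * K) ^ q * (n * n ^ (q + l))         ≡⟨ lem ((2 * K) ^ q) n (n ^ (q + l)) ⟩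
  n * ((2 * K) ^ q * n ^ (q + l)) ∎)
  where
  open ≤-Reasoning
  q = suc l
  lem : ∀ a b c → a * (b * c) ≡ b * (a * c)
  lem = solve-∀

-- The assumption `P 0` covers the default value in the maximum that defines `ex`.
ex-all : ∀ {n h} {H : Graph h} {𝓕} {P : ℕ → Set} → P 0 → (∀ (G : Graph n) → Free 𝓕 G → P (copies H G)) → P (ex n H 𝓕)
ex-all {n} {H = H} {𝓕} {P} p₀ p = argmax-all (λ c → c) p₀ (All.tabulate λ c∈ →
  let G , G∈ , e = ∈-map⁻ (copies H) c∈ in
  subst P (sym e) (p G (proj₂ (∈-filter⁻ (free? 𝓕) {xs = graphs n} G∈))))

upper : ∀ k l → l < k → 2 ≤ l → O[n^ suc l + l / suc l ] λ n → ex n (C (suc (2 * l))) (family k l)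
upper k l l<k 2≤l = 2 * K , 1 , 0<2K , λ n 1≤n →
  ex-all {H = C (suc (2 * l))} {family k l} {P = λ c → c ^ suc l ≤ (2 * K) ^ suc l * n ^ (suc l + l)} z≤n
    λ G free → bound n G 1≤n free (root l n)
  where
  1≤l = ≤-trans (n≤1+n 1) 2≤l
  D = 2 * k + 3
  K = suc (2 * l) * (2 * D * (2 * D + 2))
  0<2K : 0 < 2 * K
  0<2K = *-mono-≤ {1} {2} {1} (s≤s z≤n) (*-mono-≤ {1} {suc (2 * l)} {1} (s≤s z≤n)
    (*-mono-≤ {1} {2 * D} {1} (≤-trans (≤-trans (s≤s z≤n) (m≤n+m 3 (2 * k))) (m≤m+n D _)) (≤-trans (s≤s z≤n) (m≤n+m 2 (2 * D)))))
  bound : ∀ n (G : Graph n) → 1 ≤ n → Free (family k l) G → (∃ λ Δ → Δ ^ suc l ≤ n × n < suc Δ ^ suc l) →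
          copies (C (suc (2 * l))) G ^ suc l ≤ (2 * K) ^ suc l * n ^ (suc l + l)
  bound n G 1≤n free (Δ , lo , hi) = upper-arithmetic l n Δ (copies (C (suc (2 * l))) G) K 1≤n
    (n≢0⇒n>0 λ { refl → <⇒≱ hi (≤-trans (≤-reflexive (^-zeroˡ (suc l))) 1≤n) }) hi
    (≤-trans (Upper.Threshold.copies-bound G k l l<k 1≤l (Free⇒girth {k = k} {l} {G} free) (Free⇒noC₂ₖ {k = k} {l} {G} free) Δ lo)
             (≤-reflexive (lem (suc (2 * l)) D (n * n))))
    where
    lem : ∀ a d b → a * (2 * d * ((2 * d + 2) * b)) ≡ a * (2 * d * (2 * d + 2)) * b
    lem = solve-∀

-- One factor n of n^(q+1) is replaced by (s + 1)^q ≤ (2s)^q, which leaves the q-th power of 2ns.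
lower-arithmetic : ∀ q n N s e → 2 ≤ s → n < suc s ^ q → n * s ≤ 4 * N * e → n ^ (q + 1) ≤ (8 * N * e) ^ q
lower-arithmetic q n N s e 2≤s hi ns≤ = begin
  n ^ (q + 1)                 ≡⟨ trans (^-distribˡ-+-* n q 1) (cong (n ^ q *_) (*-identityʳ n)) ⟩
  n ^ q * n                   ≤⟨ *-monoʳ-≤ (n ^ q) (<⇒≤ hi) ⟩
  n ^ q * suc s ^ q           ≡⟨ ^-distribˡ-* n (suc s) q ⟨
  (n * suc s) ^ q             ≤⟨ ^-monoˡ-≤ q (*-monoʳ-≤ n 1+s≤2s) ⟩
  (n * (2 * s)) ^ q           ≤⟨ ^-monoˡ-≤ q (≤-trans (≤-reflexive (lem₁ n s)) (*-monoʳ-≤ 2 ns≤)) ⟩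
  (2 * (4 * N * e)) ^ q       ≡⟨ cong (_^ q) (lem₂ N e) ⟩
  (8 * N * e) ^ q             ∎
  where
  open ≤-Reasoning
  1+s≤2s : suc s ≤ 2 * s
  1+s≤2s = ≤-trans (+-monoˡ-≤ s (≤-trans (n≤1+n 1) 2≤s)) (≤-reflexive (cong (s +_) (sym (+-identityʳ s))))
  lem₁ : ∀ n s → n * (2 * s) ≡ 2 * (n * s)
  lem₁ = solve-∀
  lem₂ : ∀ a e → 2 * (4 * a * e) ≡ 8 * a * e
  lem₂ = solve-∀

-- The left side is at most N(2s)^(r+1), and the constant N 2^(r+1) is absorbed by one more factor
-- s. With r = 2k - 1 this is s^(2k+1), which explains the exponent in the lower bound.
room-arithmetic : ∀ r N s n → N * 2 ^ suc r + 2 ≤ s → s ^ suc (suc r) ≤ n → 2 * (N * (2 + s) ^ r) ≤ n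
room-arithmetic r N s n s₀≤s lo = begin
  2 * (N * (2 + s) ^ r)                     ≡⟨ lem N _ ⟩
  N * (2 * (2 + s) ^ r)                     ≤⟨ *-monoʳ-≤ N (*-monoˡ-≤ ((2 + s) ^ r) (m≤m+n 2 s)) ⟩
  N * (2 + s) ^ suc r                       ≤⟨ *-monoʳ-≤ N (^-monoˡ-≤ (suc r) 2+s≤2s) ⟩
  N * (2 * s) ^ suc r                       ≡⟨ cong (N *_) (^-distribˡ-* 2 s (suc r)) ⟩
  N * (2 ^ suc r * s ^ suc r)               ≡⟨ *-assoc N _ _ ⟨
  N * 2 ^ suc r * s ^ suc r                 ≤⟨ *-monoˡ-≤ (s ^ suc r) (≤-trans (m≤m+n _ 2) s₀≤s) ⟩
  s ^ suc (suc r)                           ≤⟨ lo ⟩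
  n ∎
  where
  open ≤-Reasoning
  2+s≤2s : 2 + s ≤ 2 * s
  2+s≤2s = ≤-trans (+-monoˡ-≤ s (≤-trans (m≤n+m 2 _) s₀≤s)) (≤-reflexive (cong (s +_) (sym (+-identityʳ s))))
  lem : ∀ a b → 2 * (a * b) ≡ a * (2 * b)
  lem = solve-∀

lower : ∀ k l → l < k → 2 ≤ l → Ω[n^ suc (2 * k) + 1 / suc (2 * k) ] λ n → ex n (C (suc (2 * l))) (family k l)
lower k l l<k 2≤l = 8 * N , s₀ ^ suc (2 * k) , s≤s z≤n , λ n n≥ → bound n n≥ (root (2 * k) n)
  where
  N = suc (2 * l)
  -- The least root that `room-arithmetic` accepts; n ≥ s₀^(2k+1) forces the root `s` of `n` to be
  -- at least `s₀`.
  s₀ = N * 2 ^ (2 * k) + 2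
  2≤k = ≤-trans 2≤l (<⇒≤ l<k)
  2≤N : 2 ≤ N
  2≤N = m≤n⇒m≤1+n (≤-trans 2≤l (m≤m+n l _))
  suc-r : suc (pred (2 * k)) ≡ 2 * k
  suc-r = suc-pred (2 * k) {{>-nonZero (≤-trans (s≤s z≤n) (*-monoʳ-≤ 2 2≤k))}}
  bound : ∀ n → s₀ ^ suc (2 * k) ≤ n → (∃ λ s → s ^ suc (2 * k) ≤ n × n < suc s ^ suc (2 * k)) →
          n ^ (suc (2 * k) + 1) ≤ (8 * N * ex n (C (suc (2 * l))) (family k l)) ^ suc (2 * k)
  bound n n≥ (s , lo , hi) = lower-arithmetic (suc (2 * k)) n N s (ex n (C (suc (2 * l))) (family k l))
      (≤-trans (m≤n+m 2 _) s₀≤s) hi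
      (≤-trans many (*-monoʳ-≤ (4 * N) (copies≤ex {H = C (suc (2 * l))} {family k l} {G} (cycles⇒Free {k = k} {l} {G} l<k 2≤l only))))
    where
    s₀≤s : s₀ ≤ s
    s₀≤s = ≮⇒≥ λ s<s₀ → <⇒≱ hi (≤-trans (^-monoˡ-≤ (suc (2 * k)) s<s₀) n≥)
    room : 2 * (N * (2 + s) ^ pred (2 * k)) ≤ n
    room = room-arithmetic (pred (2 * k)) N s n
      (subst (λ r → N * 2 ^ r + 2 ≤ s) (sym suc-r) s₀≤s) (subst (λ r → s ^ suc r ≤ n) (sym suc-r) lo)
    greedy = Greedy.many-copies n k N s 2≤N 2≤k room
    G = proj₁ greedy
    only = proj₁ (proj₂ greedy)
    many = proj₂ (proj₂ greedy)

theorem13 : ∀ (k l : ℕ) → l < k → 2 ≤ l →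
    let f = λ (n : ℕ) → ex n (C (suc (2 * l))) (cycles3to (2 * l) ++ [ (2 * k , C (2 * k)) ])
    in Ω[n^ suc (2 * k) + 1 / suc (2 * k) ] f × O[n^ suc l + l / suc l ] f
theorem13 k l l<k 2≤l = lower k l l<k 2≤l , upper k l l<k 2≤l
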